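{- Let ${\sf Lattice}$ be the following formula about a countable partial order $P$: $$\forall a,b\in P\ \exists c,d\in P\ \forall e\in P\ \big[c\le_P a,b\le_P d\ \wedge\ (e\le_P a,b\to e\le_P c)\ \wedge\ (a,b\le_P e\to d\le_P e)\big].$$ Then ${\sf Lattice}$ is $\forall\forall^\infty$-dicomplete.
   Context: Quantifiers range over $\omega$. $\exists^\infty n\,\varphi(n)$ means $\forall m\exists n\ge m\,\varphi(n)$ and $\forall^\infty n\,\varphi(n)$ means $\exists m\forall n\ge m\,\varphi(n)$. A quantifier-pattern is a finite string $\bar{\mathsf Q}=\mathsf Q_0\dots\mathsf Q_\ell$ over $\{\exists,\forall,\exists^\infty,\forall^\infty\}$. A $\bar{\mathsf Q}$-formula is $\varphi(\bar x)\equiv\mathsf Q_0n_0\dots\mathsf Q_\ell n_\ell\,\theta(n_0,\dots,n_\ell,\bar x)$ with $\theta$ a bounded formula. The instance $\bar x$ is a tuple of natural numbers and/or total computable functions (computable elements of $\omega^\omega$). Spaces such as $\omega\times\omega^\omega$, $(\omega^\omega)^\omega$, $\omega^{\omega\times\omega}$ are identified with $\omega^\omega$ by computable pairing. Witnesses: for $\alpha\in\omega^\omega$, $\alpha\Vdash\varphi(\bar x)$ ("$\alpha$ is a witness for $\varphi(\bar x)$") is defined by: $\alpha\Vdash\theta(\bar x)$ iff $\alpha=\bar x$ and $\theta(\bar x)$, for bounded $\theta$; $\langle t,\alpha\rangle\Vdash\exists n\varphi(n,\bar x)$ iff $\alpha\Vdash\varphi(t,\bar x)$; $\alpha\Vdash\forall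 n\varphi(n,\bar x)$ iff $\alpha(n)\Vdash\varphi(n,\bar x)$ for all $n$; $\langle t,\alpha\rangle\Vdash\forall^\infty n\varphi(n,\bar x)$ iff $\alpha(n)\Vdash\varphi(n,\bar x)$ for all $n\ge t$; $\alpha\Vdash\exists^\infty n\varphi(n,\bar x)$ iff for all $n$, writing $\alpha(n)=\langle k,\beta\rangle$, $k\ge n$ and $\beta\Vdash\varphi(k,\bar x)$. Reducibility: $\varphi\le_{\sf m}\psi$ if there are computable functions $\eta,r_-,r_+$ (type-two computable functionals, possibly partial but defined wherever required) such that for every instance $\bar x$: $\varphi(\bar x)$ is true iff $\psi(\eta(\bar x))$ is true; $\alpha\Vdash\varphi(\bar x)$ implies $r_-(\alpha,\bar x)\Vdash\psi(\eta(\bar x))$; $\alpha\Vdash\psi(\eta(\bar x))$ implies $r_+(\alpha,\bar x)\Vdash\varphi(\bar x)$ ($\alpha\in\omega^\omega$ arbitrary). The dual $\varphi^{\sf d}$ of $\mathsf Q_0n_0\dots\mathsf Q_\ell n_\ell\,\theta$ is $\mathsf Q_0^{\sf d}n_0\dots\mathsf Q_\ell^{\sf d}n_\ell\,\neg\theta$, where $\exists^{\sf d}=\forall$, $\forall^{\sf d}=\exists$, $(\exists^\infty)^{\sf d}=\forall^\infty$, $(\forall^\infty)^{\sf d}=\exists^\infty$. $\varphi\le_{\sf dm}\psi$ if $\varphi\le_{\sf m}\psi$ and $\varphi^{\sf d}\le_{\sf m}\psi^{\sf d}$ via a common $\eta$ (the $r_\pm$ may differ). $\varphi$ is strictly $\bar{\mathsf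 Q}$-dicomplete if it is a $\bar{\mathsf Q}$-formula and $\psi\le_{\sf dm}\varphi$ for every $\bar{\mathsf Q}$-formula $\psi$; it is $\bar{\mathsf Q}$-dicomplete if it is $\equiv_{\sf dm}$-equivalent to a strictly $\bar{\mathsf Q}$-dicomplete formula (one such is $\mathsf Q_0n_0\dots\mathsf Q_\ell n_\ell.\ x(n_0,\dots,n_\ell)=0$). Structures: a countable binary relation $(X,R)$, $X\subseteq\omega$, $R\subseteq X^2$, is coded by the pair of characteristic functions of $X$ and $R$, and is identified with its code. For a problem about a class of structures, instances are (computable) codes of structures in the class; reductions from it need only work on such codes and reductions to it must output such codes. Restricted quantifiers $\forall a\in P$, $\exists a\in P$ mean $\forall a(a\in P\to\cdots)$, $\exists a(a\in P\wedge\cdots)$, with these decidable conditions moved into the innermost bounded part; blocks of like quantifiers are contracted by pairing. -}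

module Defs where

open import Data.Nat using (ℕ; zero; suc; _+_; _*_; _≤_; _<_)
open import Data.Nat.Properties using (+-suc; +-comm; +-identityʳ; suc-injective)
open import Data.Fin using (Fin; zero; suc)
open import Data.List using (List; []; _∷_)
open import Data.Vec using (Vec; []; _∷_; lookup; foldr′)
open import Data.Vec.Relation.Unary.All using (All)
open import Data.Vec.Relation.Binary.Pointwise.Inductive using (Pointwise)
open import Data.Product using (Σ; ∃; ∃-syntax; _×_; _,_; proj₁; proj₂)
open import Data.Sum using (_⊎_)
open import Data.Unit using (⊤)
open import Function using (_∘_; _on_; _⇔_)
open import Relation.Nullary using (¬_)
open import Relation.Binary.Structures using (IsPartialOrder)
open import Relation.Binary.PropositionalEquality
  using (_≡_; _≗_; refl; sym; trans; cong)

private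
  variable
    k n m p q p′ q′ : ℕ

-- Pairing of numbers (Cantor's), with proofs that it is a bijection.

triangle : ℕ → ℕ
triangle zero    = 0
triangle (suc n) = suc n + triangle n

pair : ℕ → ℕ → ℕ
pair a b = triangle (a + b) + b

next : ℕ × ℕ → ℕ × ℕ
next (zero  , b) = suc b , 0
next (suc a , b) = a , suc b

unpair : ℕ → ℕ × ℕ
unpair zero    = 0 , 0
unpair (suc n) = next (unpair n)

fst snd : ℕ → ℕ
fst = proj₁ ∘ unpair
snd = proj₂ ∘ unpair

pair-next : ∀ a b → let (a′ , b′) = next (a , b) in pair a′ b′ ≡ suc (pair a b)
pair-next zero b
  rewrite +-identityʳ b | +-identityʳ (b + triangle b) = cong suc (+-comm b (triangle b))
pair-next (suc a) b
  rewrite +-suc a b = +-suc (suc (a + b) + triangle (a + b)) b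

pair-unpair : ∀ n → pair (fst n) (snd n) ≡ n
pair-unpair zero    = refl
pair-unpair (suc n) = trans (pair-next (fst n) (snd n)) (cong suc (pair-unpair n))

unpair-pair : ∀ a b → unpair (pair a b) ≡ (a , b)
unpair-pair a b = go (a + b) a b refl
  where
  go : ∀ s a b → a + b ≡ s → unpair (pair a b) ≡ (a , b)
  go s       a       (suc b) eq = trans (cong unpair (pair-next (suc a) b))
    (cong next (go s (suc a) b (trans (sym (+-suc a b)) eq)))
  go s       zero    zero    eq = refl
  go (suc s) (suc a) zero    eq = trans (cong unpair (pair-next 0 a))
    (cong next (go s zero a (trans (sym (+-identityʳ a)) (suc-injective eq))))

-- Codings on Baire space: ω × ω^ω, (ω^ω)^ω and ω^ω × ω^ω are identified with
-- ω^ω through  cons,  row  and  join  respectively.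

Baire : Set
Baire = ℕ → ℕ

cons : ℕ → Baire → Baire
cons t α zero    = t
cons t α (suc n) = α n

head : Baire → ℕ
head α = α 0

tail : Baire → Baire
tail α = α ∘ suc

row : Baire → ℕ → Baire
row α n m = α (pair n m)

join : Baire → Baire → Baire
join α β zero          = α 0
join α β (suc zero)    = β 0
join α β (suc (suc n)) = join (tail α) (tail β) n

-- Partial recursive functions relative to k oracles: `Code k n` consists of the
-- n-ary ones, and `oracles ⊢ c · xs ↦ y` says that c halts on xs with output y.

data Code (k : ℕ) : ℕ → Set where
  zeroᶜ   : Code k 0
  sucᶜ    : Code k 1
  projᶜ   : Fin n → Code k n
  oracleᶜ : Fin k → Code k 1
  compᶜ   : Code k m → Vec (Code k n) m → Code k n
  recᶜ    : Code k n → Code k (suc (suc n)) → Code k (suc n)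
  μᶜ      : Code k (suc n) → Code k n

infix 4 _⊢_·_↦_

data _⊢_·_↦_ (αs : Vec Baire k) : Code k n → Vec ℕ n → ℕ → Set where
  zero↦   : αs ⊢ zeroᶜ · [] ↦ 0
  suc↦    : ∀ {x} → αs ⊢ sucᶜ · (x ∷ []) ↦ suc x
  proj↦   : ∀ {xs : Vec ℕ n} {i} → αs ⊢ projᶜ i · xs ↦ lookup xs i
  oracle↦ : ∀ {i x} → αs ⊢ oracleᶜ i · (x ∷ []) ↦ lookup αs i x
  comp↦   : ∀ {f : Code k m} {gs : Vec (Code k n) m} {xs ys z} →
            Pointwise (λ g y → αs ⊢ g · xs ↦ y) gs ys →
            αs ⊢ f · ys ↦ z →
            αs ⊢ compᶜ f gs · xs ↦ z
  rec↦0   : ∀ {f : Code k n} {g xs y} →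
            αs ⊢ f · xs ↦ y →
            αs ⊢ recᶜ f g · (0 ∷ xs) ↦ y
  rec↦suc : ∀ {f : Code k n} {g xs t y z} →
            αs ⊢ recᶜ f g · (t ∷ xs) ↦ y →
            αs ⊢ g · (t ∷ y ∷ xs) ↦ z →
            αs ⊢ recᶜ f g · (suc t ∷ xs) ↦ z
  μ↦      : ∀ {f : Code k (suc n)} {xs t} →
            (∀ i → i < t → ∃[ v ] αs ⊢ f · (i ∷ xs) ↦ suc v) →
            αs ⊢ f · (t ∷ xs) ↦ 0 →
            αs ⊢ μᶜ f · xs ↦ t

-- A unary code is a partial computable functional: it is defined at the oracles
-- αs, with value β, when it computes the total function β from them.

Computes : Code k 1 → Vec Baire k → Baire → Set
Computes c αs β = ∀ n → αs ⊢ c · (n ∷ []) ↦ β n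

Computable : Baire → Set
Computable β = ∃[ c ] Computes c [] β

record Instance (p q : ℕ) : Set where
  constructor inst
  field
    nums : Vec ℕ p
    funs : Vec Baire q

open Instance public

infixr 5 _◂_

_◂_ : ℕ → Instance p q → Instance (suc p) q
n ◂ inst ns fs = inst (n ∷ ns) fs

merge : Vec Baire q → Baire
merge []           = λ _ → 0
merge (f ∷ [])     = f
merge (f ∷ g ∷ fs) = join f (merge (g ∷ fs))

-- The tuple as an element of ω^ω; a single function is its own code.
code : Instance p q → Baire
code (inst ns fs) = foldr′ cons (merge fs) ns

ComputableInstance : Instance p q → Set
ComputableInstance x = All Computable (funs x)

-- Bounded formulas with p number variables and q function variables.  Having
-- symbols for pairing and its projections, the matrix can refer to the
-- components of contracted quantifiers and to functions of several arguments.

data Term (p q : ℕ) : Set where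
  var        : Fin p → Term p q
  app        : Fin q → Term p q → Term p q
  zeroᵗ      : Term p q
  sucᵗ       : Term p q → Term p q
  _+ᵗ_ _*ᵗ_  : Term p q → Term p q → Term p q
  pairᵗ      : Term p q → Term p q → Term p q
  fstᵗ sndᵗ  : Term p q → Term p q

infix  6 _≐_ _≤ᵇ_
infix  5 ¬ᵇ_
infixr 4 _∧ᵇ_
infixr 3 _∨ᵇ_
infixr 2 _⇒ᵇ_

data Bounded (p q : ℕ) : Set where
  _≐_ _≤ᵇ_         : Term p q → Term p q → Bounded p q
  ¬ᵇ_              : Bounded p q → Bounded p q
  _∧ᵇ_ _∨ᵇ_ _⇒ᵇ_   : Bounded p q → Bounded p q → Bounded p q
  ∀<_∙_ ∃<_∙_      : Term p q → Bounded (suc p) q → Bounded p q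

⟦_⟧ᵗ : Term p q → Instance p q → ℕ
⟦ var i ⟧ᵗ     x = lookup (nums x) i
⟦ app i t ⟧ᵗ   x = lookup (funs x) i (⟦ t ⟧ᵗ x)
⟦ zeroᵗ ⟧ᵗ     x = 0
⟦ sucᵗ t ⟧ᵗ    x = suc (⟦ t ⟧ᵗ x)
⟦ s +ᵗ t ⟧ᵗ    x = ⟦ s ⟧ᵗ x + ⟦ t ⟧ᵗ x
⟦ s *ᵗ t ⟧ᵗ    x = ⟦ s ⟧ᵗ x * ⟦ t ⟧ᵗ x
⟦ pairᵗ s t ⟧ᵗ x = pair (⟦ s ⟧ᵗ x) (⟦ t ⟧ᵗ x)
⟦ fstᵗ t ⟧ᵗ    x = fst (⟦ t ⟧ᵗ x)
⟦ sndᵗ t ⟧ᵗ    x = snd (⟦ t ⟧ᵗ x)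

⟦_⟧ᵇ : Bounded p q → Instance p q → Set
⟦ s ≐ t ⟧ᵇ    x = ⟦ s ⟧ᵗ x ≡ ⟦ t ⟧ᵗ x
⟦ s ≤ᵇ t ⟧ᵇ   x = ⟦ s ⟧ᵗ x ≤ ⟦ t ⟧ᵗ x
⟦ ¬ᵇ θ ⟧ᵇ     x = ¬ ⟦ θ ⟧ᵇ x
⟦ θ ∧ᵇ ξ ⟧ᵇ   x = ⟦ θ ⟧ᵇ x × ⟦ ξ ⟧ᵇ x
⟦ θ ∨ᵇ ξ ⟧ᵇ   x = ⟦ θ ⟧ᵇ x ⊎ ⟦ ξ ⟧ᵇ x
⟦ θ ⇒ᵇ ξ ⟧ᵇ   x = ⟦ θ ⟧ᵇ x → ⟦ ξ ⟧ᵇ x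
⟦ ∀< t ∙ θ ⟧ᵇ x = ∀ n → n < ⟦ t ⟧ᵗ x → ⟦ θ ⟧ᵇ (n ◂ x)
⟦ ∃< t ∙ θ ⟧ᵇ x = ∃[ n ] n < ⟦ t ⟧ᵗ x × ⟦ θ ⟧ᵇ (n ◂ x)

data Quantifier : Set where
  `∃ `∀ `∃∞ `∀∞ : Quantifier

Pattern : Set
Pattern = List Quantifier

-- Variables are de Bruijn indices: `var zero` is bound by the innermost quantifier.
data Formula : Pattern → ℕ → ℕ → Set where
  matrix : Bounded p q → Formula [] p q
  quant  : ∀ Q {Qs} → Formula Qs (suc p) q → Formula (Q ∷ Qs) p q

infix 3 _⊩_[_]

True : ∀ {Qs} → Formula Qs p q → Instance p q → Set
True (matrix θ)    x = ⟦ θ ⟧ᵇ x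
True (quant `∃ φ)  x = ∃[ n ] True φ (n ◂ x)
True (quant `∀ φ)  x = ∀ n → True φ (n ◂ x)
True (quant `∃∞ φ) x = ∀ m → ∃[ n ] m ≤ n × True φ (n ◂ x)
True (quant `∀∞ φ) x = ∃[ m ] (∀ n → m ≤ n → True φ (n ◂ x))

-- In the matrix case the instance x already includes the values of the
-- quantified variables.
_⊩_[_] : ∀ {Qs} → Baire → Formula Qs p q → Instance p q → Set
α ⊩ matrix θ    [ x ] = α ≗ code x × ⟦ θ ⟧ᵇ x
α ⊩ quant `∃ φ  [ x ] = tail α ⊩ φ [ head α ◂ x ]
α ⊩ quant `∀ φ  [ x ] = ∀ n → row α n ⊩ φ [ n ◂ x ]
α ⊩ quant `∃∞ φ [ x ] = ∀ n → n ≤ head (row α n) ×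
                              (tail (row α n) ⊩ φ [ head (row α n) ◂ x ])
α ⊩ quant `∀∞ φ [ x ] = ∀ n → head α ≤ n → row (tail α) n ⊩ φ [ n ◂ x ]

dualQ : Quantifier → Quantifier
dualQ `∃  = `∀
dualQ `∀  = `∃
dualQ `∃∞ = `∀∞
dualQ `∀∞ = `∃∞

dualP : Pattern → Pattern
dualP []       = []
dualP (Q ∷ Qs) = dualQ Q ∷ dualP Qs

dualF : ∀ {Qs} → Formula Qs p q → Formula (dualP Qs) p q
dualF (matrix θ)  = matrix (¬ᵇ θ)
dualF (quant Q φ) = quant (dualQ Q) (dualF φ)

-- A formula whose instances are the computable tuples in a given class.
record Problem (p q : ℕ) : Set₁ where
  constructor problem
  field
    {pattern′} : Pattern
    formula    : Formula pattern′ p q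
    Class      : Instance p q → Set

  IsInstance : Instance p q → Set
  IsInstance x = ComputableInstance x × Class x

open Problem public

unrestricted : ∀ {Qs} → Formula Qs p q → Problem p q
unrestricted φ = problem φ (λ _ → ⊤)

dual : Problem p q → Problem p q
dual (problem φ C) = problem (dualF φ) C

Reduction : Code 1 1 → Problem p q → Problem p′ q′ → Set
Reduction {p′ = p′} {q′ = q′} η (problem φ C) (problem ψ D) =
  Σ (Code 2 1) λ r₋ → Σ (Code 2 1) λ r₊ →
    ∀ x → IsInstance (problem φ C) x →
      Σ (Instance p′ q′) λ y →
        IsInstance (problem ψ D) y ×
        Computes η (code x ∷ []) (code y) ×
        (True φ x ⇔ True ψ y) ×
        (∀ α → α ⊩ φ [ x ] →
          ∃[ β ] Computes r₋ (α ∷ code x ∷ []) β × (β ⊩ ψ [ y ])) ×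
        (∀ α → α ⊩ ψ [ y ] →
          ∃[ β ] Computes r₊ (α ∷ code x ∷ []) β × (β ⊩ φ [ x ]))

infix 4 _≤m_ _≤dm_ _≡dm_

_≤m_ : Problem p q → Problem p′ q′ → Set
A ≤m B = ∃[ η ] Reduction η A B

_≤dm_ : Problem p q → Problem p′ q′ → Set
A ≤dm B = ∃[ η ] Reduction η A B × Reduction η (dual A) (dual B)

_≡dm_ : Problem p q → Problem p′ q′ → Set
A ≡dm B = A ≤dm B × B ≤dm A

StrictlyDicomplete : ∀ {Qs} → Formula Qs p q → Set
StrictlyDicomplete {Qs = Qs} φ =
  ∀ {p′ q′} (ψ : Formula Qs p′ q′) → unrestricted ψ ≤dm unrestricted φ

Dicomplete : Pattern → Problem p q → Set
Dicomplete Qs A =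
  ∃[ p′ ] ∃[ q′ ] Σ (Formula Qs p′ q′) λ φ →
    StrictlyDicomplete φ × (A ≡dm unrestricted φ)

-- A countable binary relation (X , R) is coded by the characteristic functions
-- χ of X and ρ of R, the latter taking pairs as arguments.

record IsRelationCode (χ ρ : Baire) : Set where
  field
    χ-01 : ∀ a → χ a ≤ 1
    ρ-01 : ∀ c → ρ c ≤ 1
    R⊆X² : ∀ a b → ρ (pair a b) ≡ 1 → χ a ≡ 1 × χ b ≡ 1

record IsPosetCode (χ ρ : Baire) : Set where
  field
    isRelationCode : IsRelationCode χ ρ

  Elem : Set
  Elem = ∃[ a ] χ a ≡ 1

  _⊑_ : Elem → Elem → Set
  (a , _) ⊑ (b , _) = ρ (pair a b) ≡ 1

  field
    isPartialOrder : IsPartialOrder (_≡_ on proj₁) _⊑_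

PosetInstance : Instance 0 2 → Set
PosetInstance (inst [] (χ ∷ ρ ∷ [])) = IsPosetCode χ ρ

-- The quantifiers range over u = ⟨a,b⟩, v = ⟨c,d⟩ and e.
latticeFormula : Formula (`∀ ∷ `∃ ∷ `∀ ∷ []) 0 2
latticeFormula = quant `∀ (quant `∃ (quant `∀ (matrix
    (∈P a ∧ᵇ ∈P b ⇒ᵇ
      (∈P c ∧ᵇ ∈P d) ∧ᵇ
      (∈P e ⇒ᵇ
        (c ≤P a ∧ᵇ c ≤P b ∧ᵇ a ≤P d ∧ᵇ b ≤P d) ∧ᵇ
        (e ≤P a ∧ᵇ e ≤P b ⇒ᵇ e ≤P c) ∧ᵇ
        (a ≤P e ∧ᵇ b ≤P e ⇒ᵇ d ≤P e))))))
  where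
  u v a b c d e one : Term 3 2
  u   = var (suc (suc zero))
  v   = var (suc zero)
  e   = var zero
  a   = fstᵗ u
  b   = sndᵗ u
  c   = fstᵗ v
  d   = sndᵗ v
  one = sucᵗ zeroᵗ

  ∈P : Term 3 2 → Bounded 3 2
  ∈P s = app zero s ≐ one

  infix 6 _≤P_
  _≤P_ : Term 3 2 → Term 3 2 → Bounded 3 2
  s ≤P t = app (suc zero) (pairᵗ s t) ≐ one

Lattice : Problem 0 2
Lattice = problem latticeFormula PosetInstance

{-# OPTIONS --safe #-}
-- The complete formula is ∀n ∀∞m. f ⟨n,m⟩ = 0: the test of the matrix of any
-- ∀∀∞-formula is primitive recursive, and witnesses keep their numerical part.
--
-- Lattice reduces to it because the meet c and the join d of a and b are unique.
-- For u = ⟨a,b⟩ one goes through the candidates v = ⟨c,d⟩ in order, leaving a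
-- candidate when some e ≤ m refutes it at stage m; f ⟨u,m⟩ = 0 says that stage m
-- does not leave the candidate. If v is correct, then all other candidates are
-- refuted by c or by d, which bounds the stage at which v is settled on.
-- Conversely the limit candidate is correct, and infinitely many moves refute
-- every candidate.
--
-- For the converse reduction, the poset of f consists of blocks one above the
-- other. The n-th block is an ascending chain, with a least element and one for
-- each m > 2 such that f ⟨n,m⟩ ≠ 0, below two incomparable elements. Their join is
-- the least element of the next block; their meet is the last element of the
-- chain, if there is one.
module Submission where

open import Defs
open import Data.Fin using (Fin; zero; suc; toℕ; splitAt)
open import Data.Fin.Patterns using (0F; 1F; 2F; 3F)
open import Data.List using ([]; _∷_)
open import Data.Nat hiding (_≤ᵇ_)
open import Data.Nat.Properties
open import Data.Product using (Σ; ∃-syntax; _×_; _,_; proj₁; proj₂)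
open import Data.Sum using (_⊎_; inj₁; inj₂; [_,_]′)
open import Data.Vec using (Vec; []; _∷_; _++_; lookup; map; tabulate)
open import Data.Vec.Properties using (lookup-splitAt)
open import Data.Vec.Relation.Unary.All using (All; []; _∷_)
open import Data.Vec.Relation.Binary.Pointwise.Inductive as Pointwise
  using (Pointwise; []; _∷_)
open import Function using (mk⇔)
open import Relation.Binary.PropositionalEquality hiding ([_])
open import Relation.Binary.Definitions using (tri<; tri≈; tri>)
open import Relation.Binary.Structures using (IsPartialOrder)
open import Relation.Nullary using (¬_; yes; no; contradiction)

private
  variable
    k n m p q p′ q′ : ℕ
    Qs : Pattern

-- Total computable functionals and their programs.

-- Codes for the oracles can be substituted into the code of a total functional,
-- so that its values at computable oracles are seen to be computable.
record Functional (k n : ℕ) : Set where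
  field
    eval    : Vec Baire k → Vec ℕ n → ℕ
    compile : ∀ {l} → Vec (Code l 1) k → Code l n
    sound   : ∀ {l} {βs : Vec Baire l} {cs αs} →
              Pointwise (λ c α → Computes c βs α) cs αs →
              ∀ xs → βs ⊢ compile cs · xs ↦ eval αs xs

open Functional

function : Functional k 1 → Vec Baire k → Baire
function F αs j = eval F αs (j ∷ [])

programOf : Functional 1 1 → Code 1 1
programOf F = compile F (oracleᶜ 0F ∷ [])

programOf-computes : ∀ F {α} → Computes (programOf F) (α ∷ []) (function F (α ∷ []))
programOf-computes F j = sound F ((λ _ → oracle↦) ∷ []) (j ∷ [])

programOf₂ : Functional 2 1 → Code 2 1
programOf₂ F = compile F (oracleᶜ 0F ∷ oracleᶜ 1F ∷ [])

programOf₂-computes : ∀ F {α β} →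
  Computes (programOf₂ F) (α ∷ β ∷ []) (function F (α ∷ β ∷ []))
programOf₂-computes F j = sound F ((λ _ → oracle↦) ∷ (λ _ → oracle↦) ∷ []) (j ∷ [])

function-computable : ∀ (F : Functional k 1) {αs} →
  Σ (Vec (Code 0 1) k) (λ cs → Pointwise (λ c α → Computes c [] α) cs αs) →
  Computable (function F αs)
function-computable F (cs , σ) = compile F cs , λ j → sound F σ (j ∷ [])

-- Keeps the program but replaces its value by a pointwise equal, readable expression. Later
-- specifications of targets and witnesses then hold by computation instead of by rewriting.
reimplements : (F : Functional k n) (f : Vec Baire k → Vec ℕ n → ℕ) →
               (∀ αs xs → eval F αs xs ≡ f αs xs) → Functional k n
eval    (reimplements F f eq) = f
compile (reimplements F f eq) = compile F
sound   (reimplements F f eq) {αs = αs} σ xs =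
  subst (_ ⊢ _ · xs ↦_) (eq αs xs) (sound F σ xs)

varᶠ : Fin n → Functional k n
eval    (varᶠ i) _ xs = lookup xs i
compile (varᶠ i) _ = projᶜ i
sound   (varᶠ i) _ _ = proj↦

litᶠ : ℕ → Functional k n
eval    (litᶠ m) _ _ = m
compile (litᶠ zero)    _  = compᶜ zeroᶜ []
compile (litᶠ (suc m)) cs = compᶜ sucᶜ (compile (litᶠ m) cs ∷ [])
sound   (litᶠ zero)    _ _  = comp↦ [] zero↦
sound   (litᶠ (suc m)) σ xs = comp↦ (sound (litᶠ m) σ xs ∷ []) suc↦

sucᶠ : Functional k n → Functional k n
eval    (sucᶠ F) αs xs = suc (eval F αs xs)
compile (sucᶠ F) cs = compᶜ sucᶜ (compile F cs ∷ [])
sound   (sucᶠ F) σ xs = comp↦ (sound F σ xs ∷ []) suc↦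

oracleᶠ : Fin k → Functional k n → Functional k n
eval    (oracleᶠ i F) αs xs = lookup αs i (eval F αs xs)
compile (oracleᶠ i F) cs = compᶜ (lookup cs i) (compile F cs ∷ [])
sound   (oracleᶠ i F) σ xs = comp↦ (sound F σ xs ∷ []) (Pointwise.lookup σ i _)

evals : Vec (Functional k n) m → Vec Baire k → Vec ℕ n → Vec ℕ m
evals Gs αs xs = map (λ G → eval G αs xs) Gs

callᶠ : Functional k m → Vec (Functional k n) m → Functional k n
eval    (callᶠ F Gs) αs xs = eval F αs (evals Gs αs xs)
compile (callᶠ F Gs) cs = compᶜ (compile F cs) (map (λ G → compile G cs) Gs)
sound   (callᶠ F Gs) {βs = βs} {cs} {αs} σ xs = comp↦ (sounds Gs) (sound F σ _)
  where
  sounds : ∀ {m} (Gs : Vec (Functional _ _) m) →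
           Pointwise (λ c y → βs ⊢ c · xs ↦ y) (map (λ G → compile G cs) Gs) (evals Gs αs xs)
  sounds []       = []
  sounds (G ∷ Gs) = sound G σ xs ∷ sounds Gs

natRec : ℕ → (ℕ → ℕ → ℕ) → ℕ → ℕ
natRec b s zero    = b
natRec b s (suc t) = s t (natRec b s t)

recᶠ : Functional k n → Functional k (2 + n) → Functional k (suc n)
eval    (recᶠ B S) αs (t ∷ xs) = natRec (eval B αs xs) (λ i y → eval S αs (i ∷ y ∷ xs)) t
compile (recᶠ B S) cs = recᶜ (compile B cs) (compile S cs)
sound   (recᶠ B S) σ (zero  ∷ xs) = rec↦0 (sound B σ xs)
sound   (recᶠ B S) σ (suc t ∷ xs) =
  rec↦suc (sound (recᶠ B S) σ (t ∷ xs)) (sound S σ (t ∷ _ ∷ xs))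

-- Translations of witnesses have the given witness as their first oracle and the instance as their
-- second. This makes functionals of the instance alone available to them.
shiftᶠ : Functional k n → Functional (suc k) n
eval    (shiftᶠ F) (_ ∷ αs) = eval F αs
compile (shiftᶠ F) (_ ∷ cs) = compile F cs
sound   (shiftᶠ F) (_ ∷ σ) = sound F σ

call₁ : Functional k 1 → Functional k n → Functional k n
call₁ F A = callᶠ F (A ∷ [])

call₂ : Functional k 2 → Functional k n → Functional k n → Functional k n
call₂ F A B = callᶠ F (A ∷ B ∷ [])

call₃ : Functional k 3 → Functional k n → Functional k n → Functional k n → Functional k n
call₃ F A B C = callᶠ F (A ∷ B ∷ C ∷ [])

-- Passing on a variable number of arguments by projections does not reduce by computation; this
-- equation is needed wherever parameters are handed through unchanged.
evals-tabulate : (f : Fin m → Fin n) (αs : Vec Baire k) (xs : Vec ℕ n) (ys : Vec ℕ m) →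
  (∀ i → lookup xs (f i) ≡ lookup ys i) → evals (tabulate (λ i → varᶠ (f i))) αs xs ≡ ys
evals-tabulate f αs xs [] eq = refl
evals-tabulate f αs xs (y ∷ ys) eq =
  cong₂ _∷_ (eq 0F) (evals-tabulate (λ i → f (suc i)) αs xs ys (λ i → eq (suc i)))

letᶠ : Functional k n → Functional k (suc n) → Functional k n
letᶠ A F = reimplements (callᶠ F (A ∷ tabulate varᶠ))
  (λ αs xs → eval F αs (eval A αs xs ∷ xs))
  (λ αs xs → cong (λ ys → eval F αs (eval A αs xs ∷ ys))
                  (evals-tabulate (λ i → i) αs xs xs (λ _ → refl)))

-- The argument left out is the previous value of a recursion or, in `leafᶠ`, the quantifier value
-- that the head already records.
skipᶠ : Functional k (suc n) → Functional k (2 + n)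
skipᶠ F = reimplements (callᶠ F (varᶠ 0F ∷ tabulate (λ i → varᶠ (suc (suc i)))))
  (λ { αs (x ∷ _ ∷ xs) → eval F αs (x ∷ xs) })
  (λ { αs (x ∷ y ∷ xs) → cong (λ ys → eval F αs (x ∷ ys))
                  (evals-tabulate (λ i → suc (suc i)) αs (x ∷ y ∷ xs) xs (λ _ → refl)) })

-- Primitive recursive arithmetic, pairing and codings of Baire space.

infixl 6 _+ᶠ_ _∸ᶠ_
infixl 7 _*ᶠ_

_+ᶠ_ : Functional k n → Functional k n → Functional k n
_+ᶠ_ = call₂ (reimplements (recᶠ (varᶠ 0F) (sucᶠ (varᶠ 1F)))
  (λ { _ (x ∷ y ∷ []) → x + y }) (λ { _ (x ∷ y ∷ []) → correct x y }))
  where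
  correct : ∀ x y → natRec y (λ _ → suc) x ≡ x + y
  correct zero    y = refl
  correct (suc x) y = cong suc (correct x y)

_*ᶠ_ : Functional k n → Functional k n → Functional k n
_*ᶠ_ = call₂ (reimplements (recᶠ (litᶠ 0) (varᶠ 2F +ᶠ varᶠ 1F))
  (λ { _ (x ∷ y ∷ []) → x * y }) (λ { _ (x ∷ y ∷ []) → correct x y }))
  where
  correct : ∀ x y → natRec 0 (λ _ z → y + z) x ≡ x * y
  correct zero    y = refl
  correct (suc x) y = cong (y +_) (correct x y)

predᶠ : Functional k n → Functional k n
predᶠ = call₁ (reimplements (recᶠ (litᶠ 0) (varᶠ 0F))
  (λ { _ (x ∷ []) → pred x }) (λ { _ (zero ∷ []) → refl ; _ (suc x ∷ []) → refl }))

_∸ᶠ_ : Functional k n → Functional k n → Functional k n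
A ∸ᶠ B = call₂ (reimplements (recᶠ (varᶠ 0F) (predᶠ (varᶠ 1F)))
  (λ { _ (y ∷ x ∷ []) → x ∸ y }) (λ { _ (y ∷ x ∷ []) → correct x y })) B A
  where
  correct : ∀ x y → natRec x (λ _ → pred) y ≡ x ∸ y
  correct x zero    = refl
  correct x (suc y) = trans (cong pred (correct x y)) (pred[m∸n]≡m∸[1+n] x y)

ifZero : ℕ → ℕ → ℕ → ℕ
ifZero zero    a b = a
ifZero (suc _) a b = b

ifZero-pos : ∀ {x a b} → 0 < x → ifZero x a b ≡ b
ifZero-pos (s≤s _) = refl

ifZeroᶠ : Functional k n → Functional k n → Functional k n → Functional k n
ifZeroᶠ = call₃ (reimplements (recᶠ (varᶠ 0F) (varᶠ 3F))
  (λ { _ (x ∷ a ∷ b ∷ []) → ifZero x a b })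
  (λ { _ (zero ∷ _ ∷ _ ∷ []) → refl ; _ (suc _ ∷ _ ∷ _ ∷ []) → refl }))

triangleᶠ : Functional k n → Functional k n
triangleᶠ = call₁ (reimplements (recᶠ (litᶠ 0) (sucᶠ (varᶠ 0F) +ᶠ varᶠ 1F))
  (λ { _ (x ∷ []) → triangle x }) (λ { _ (x ∷ []) → correct x }))
  where
  correct : ∀ x → natRec 0 (λ t y → suc t + y) x ≡ triangle x
  correct zero    = refl
  correct (suc x) = cong (suc x +_) (correct x)

pairᶠ : Functional k n → Functional k n → Functional k n
pairᶠ = call₂ (reimplements (triangleᶠ (varᶠ 0F +ᶠ varᶠ 1F) +ᶠ varᶠ 1F)
  (λ { _ (x ∷ y ∷ []) → pair x y }) (λ { _ (x ∷ y ∷ []) → refl }))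

-- The index fst j + snd j of the diagonal of j moves on exactly when the next
-- triangular number is reached.
diagonalStep : ℕ → ℕ → ℕ
diagonalStep j d = ifZero (triangle (suc d) ∸ suc j) (suc d) d

diagonal : ℕ → ℕ
diagonal = natRec 0 diagonalStep

-- The code of `(0 , b)` is the last one on its diagonal, so its successor is the next triangular
-- number. If the first component is positive, the offset `b` is still below the index of the
-- diagonal, and that number is not reached.
diagonalStep-next : ∀ a b →
  let (a′ , b′) = next (a , b) in diagonalStep (pair a b) (a + b) ≡ a′ + b′
diagonalStep-next zero b
  rewrite +-identityʳ b | +-comm b (triangle b) | n∸n≡0 (triangle b + b) = refl
diagonalStep-next (suc a) b =
  trans (ifZero-pos (m<n⇒0<n∸m below)) (sym (+-suc a b))
  where
  open ≤-Reasoning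
  d = suc a + b

  below : suc (triangle d + b) < triangle (suc d)
  below = begin-strict
    suc (triangle d + b)  ≡⟨ +-suc (triangle d) b ⟨
    triangle d + suc b    ≤⟨ +-monoʳ-≤ (triangle d) (s≤s (m≤n+m b a)) ⟩
    triangle d + d        <⟨ +-monoʳ-< (triangle d) (n<1+n d) ⟩
    triangle d + suc d    ≡⟨ +-comm (triangle d) (suc d) ⟩
    triangle (suc d)      ∎

diagonal-fst+snd : ∀ j → diagonal j ≡ fst j + snd j
diagonal-fst+snd zero    = refl
diagonal-fst+snd (suc j) = trans
  (cong₂ diagonalStep (sym (pair-unpair j)) (diagonal-fst+snd j))
  (diagonalStep-next (fst j) (snd j))

diagonalᶠ : Functional k n → Functional k n
diagonalᶠ = call₁ (reimplements
  (recᶠ (litᶠ 0) (ifZeroᶠ (triangleᶠ (sucᶠ (varᶠ 1F)) ∸ᶠ sucᶠ (varᶠ 0F)) (sucᶠ (varᶠ 1F)) (varᶠ 1F)))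
  (λ { _ (j ∷ []) → fst j + snd j }) (λ { _ (j ∷ []) → diagonal-fst+snd j }))

sndᶠ : Functional k n → Functional k n
sndᶠ = call₁ (reimplements (varᶠ 0F ∸ᶠ triangleᶠ (diagonalᶠ (varᶠ 0F)))
  (λ { _ (j ∷ []) → snd j }) (λ { _ (j ∷ []) → correct j }))
  where
  correct : ∀ j → j ∸ triangle (fst j + snd j) ≡ snd j
  correct j = trans (cong (_∸ triangle (fst j + snd j)) (sym (pair-unpair j)))
                    (m+n∸m≡n (triangle (fst j + snd j)) (snd j))

fstᶠ : Functional k n → Functional k n
fstᶠ = call₁ (reimplements (diagonalᶠ (varᶠ 0F) ∸ᶠ sndᶠ (varᶠ 0F))
  (λ { _ (j ∷ []) → fst j }) (λ { _ (j ∷ []) → m+n∸n≡m (fst j) (snd j) }))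

double : ℕ → ℕ
double zero    = 0
double (suc n) = suc (suc (double n))

doubleᶠ : Functional k n → Functional k n
doubleᶠ = call₁ (reimplements (recᶠ (litᶠ 0) (sucᶠ (sucᶠ (varᶠ 1F))))
  (λ { _ (x ∷ []) → double x }) (λ { _ (x ∷ []) → correct x }))
  where
  correct : ∀ x → natRec 0 (λ _ y → suc (suc y)) x ≡ double x
  correct zero    = refl
  correct (suc x) = cong (λ y → suc (suc y)) (correct x)

odd : ℕ → ℕ
odd zero          = 0
odd (suc zero)    = 1
odd (suc (suc n)) = odd n

odd-suc : ∀ n → 1 ∸ odd n ≡ odd (suc n)
odd-suc zero          = refl
odd-suc (suc zero)    = refl
odd-suc (suc (suc n)) = odd-suc n

⌊1+n/2⌋ : ∀ n → odd n + ⌊ n /2⌋ ≡ ⌊ suc n /2⌋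
⌊1+n/2⌋ zero          = refl
⌊1+n/2⌋ (suc zero)    = refl
⌊1+n/2⌋ (suc (suc n)) = trans (+-suc (odd n) ⌊ n /2⌋) (cong suc (⌊1+n/2⌋ n))

oddᶠ : Functional k n → Functional k n
oddᶠ = call₁ (reimplements (recᶠ (litᶠ 0) (litᶠ 1 ∸ᶠ varᶠ 1F))
  (λ { _ (x ∷ []) → odd x }) (λ { _ (x ∷ []) → correct x }))
  where
  correct : ∀ x → natRec 0 (λ _ y → 1 ∸ y) x ≡ odd x
  correct zero    = refl
  correct (suc x) = trans (cong (1 ∸_) (correct x)) (odd-suc x)

halfᶠ : Functional k n → Functional k n
halfᶠ = call₁ (reimplements (recᶠ (litᶠ 0) (oddᶠ (varᶠ 0F) +ᶠ varᶠ 1F))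
  (λ { _ (x ∷ []) → ⌊ x /2⌋ }) (λ { _ (x ∷ []) → correct x }))
  where
  correct : ∀ x → natRec 0 (λ t y → odd t + y) x ≡ ⌊ x /2⌋
  correct zero    = refl
  correct (suc x) = trans (cong (odd x +_) (correct x)) (⌊1+n/2⌋ x)

consᶠ : Functional k n → Functional k (suc n) → Functional k (suc n)
consᶠ H T = reimplements (recᶠ H (skipᶠ T))
  (λ { αs (j ∷ xs) → cons (eval H αs xs) (λ i → eval T αs (i ∷ xs)) j })
  (λ { αs (zero ∷ xs) → refl ; αs (suc j ∷ xs) → refl })

join-ifZero : ∀ α β j → ifZero (odd j) (α ⌊ j /2⌋) (β ⌊ j /2⌋) ≡ join α β j
join-ifZero α β zero          = refl
join-ifZero α β (suc zero)    = refl
join-ifZero α β (suc (suc j)) = join-ifZero (tail α) (tail β) j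

join-double : ∀ α β j → join α β (double j) ≡ α j
join-double α β zero    = refl
join-double α β (suc j) = join-double (tail α) (tail β) j

join-1+double : ∀ α β j → join α β (suc (double j)) ≡ β j
join-1+double α β zero    = refl
join-1+double α β (suc j) = join-1+double (tail α) (tail β) j

joinᶠ : Functional k 1 → Functional k 1 → Functional k 1
joinᶠ F G = reimplements
  (ifZeroᶠ (oddᶠ (varᶠ 0F)) (call₁ F (halfᶠ (varᶠ 0F))) (call₁ G (halfᶠ (varᶠ 0F))))
  (λ { αs (j ∷ []) → join (function F αs) (function G αs) j })
  (λ { αs (j ∷ []) → join-ifZero (function F αs) (function G αs) j })

∑< : ℕ → (ℕ → ℕ) → ℕ
∑< zero    f = 0
∑< (suc t) f = f t + ∑< t f

∑ᶠ : Functional k (suc n) → Functional k (suc n)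
∑ᶠ F = reimplements (recᶠ (litᶠ 0) (skipᶠ F +ᶠ varᶠ 1F))
  (λ { αs (t ∷ xs) → ∑< t (λ i → eval F αs (i ∷ xs)) })
  (λ { αs (t ∷ xs) → correct αs xs t })
  where
  correct : ∀ αs xs t → natRec 0 (λ i y → eval F αs (i ∷ xs) + y) t ≡
                        ∑< t (λ i → eval F αs (i ∷ xs))
  correct αs xs zero    = refl
  correct αs xs (suc t) = cong (eval F αs (t ∷ xs) +_) (correct αs xs t)

∏< : ℕ → (ℕ → ℕ) → ℕ
∏< zero    f = 1
∏< (suc t) f = f t * ∏< t f

∏ᶠ : Functional k (suc n) → Functional k (suc n)
∏ᶠ F = reimplements (recᶠ (litᶠ 1) (skipᶠ F *ᶠ varᶠ 1F))
  (λ { αs (t ∷ xs) → ∏< t (λ i → eval F αs (i ∷ xs)) })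
  (λ { αs (t ∷ xs) → correct αs xs t })
  where
  correct : ∀ αs xs t → natRec 1 (λ i y → eval F αs (i ∷ xs) * y) t ≡
                        ∏< t (λ i → eval F αs (i ∷ xs))
  correct αs xs zero    = refl
  correct αs xs (suc t) = cong (eval F αs (t ∷ xs) *_) (correct αs xs t)

-- The position inside the row comes first and the number of the row second, since the values of
-- quantifiers are listed after the position, the innermost one first.
unrowᶠ : Functional k (2 + n) → Functional k (suc n)
unrowᶠ F = reimplements
  (callᶠ F (sndᶠ (varᶠ 0F) ∷ fstᶠ (varᶠ 0F) ∷ tabulate (λ i → varᶠ (suc i))))
  (λ { αs (j ∷ xs) → eval F αs (snd j ∷ fst j ∷ xs) })
  (λ { αs (j ∷ xs) → cong (λ ys → eval F αs (snd j ∷ fst j ∷ ys))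
                          (evals-tabulate suc αs (j ∷ xs) xs (λ _ → refl)) })

-- Witnesses and truth.

infixr 4 _◂◂_

_◂◂_ : Vec ℕ n → Instance p q → Instance (n + p) q
xs ◂◂ x = inst (xs ++ nums x) (funs x)

-- Stands in for function extensionality, as a function assembled from rows has these rows only
-- pointwise. Where a quantifier reads a number off the witness, the instance is transported as
-- well.
⊩-cong : ∀ (φ : Formula Qs p q) {α β x} → α ≗ β → α ⊩ φ [ x ] → β ⊩ φ [ x ]
⊩-cong (matrix θ) eq (leaf , true) = (λ j → trans (sym (eq j)) (leaf j)) , true
⊩-cong (quant `∃ φ) {x = x} eq w =
  subst (λ t → _ ⊩ φ [ t ◂ x ]) (eq 0) (⊩-cong φ (λ j → eq (suc j)) w)
⊩-cong (quant `∀ φ) eq w n = ⊩-cong φ (λ j → eq (pair n j)) (w n)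
⊩-cong (quant `∃∞ φ) {x = x} eq w n =
  subst (n ≤_) (eq (pair n 0)) (proj₁ (w n)) ,
  subst (λ t → _ ⊩ φ [ t ◂ x ]) (eq (pair n 0))
        (⊩-cong φ (λ j → eq (pair n (suc j))) (proj₂ (w n)))
⊩-cong (quant `∀∞ φ) eq w n t≤n =
  ⊩-cong φ (λ j → eq (suc (pair n j))) (w n (subst (_≤ n) (sym (eq 0)) t≤n))

rows : (ℕ → Baire) → Baire
rows f j = f (fst j) (snd j)

row-rows : ∀ f n → f n ≗ row (rows f) n
row-rows f n j rewrite unpair-pair n j = refl

⊩-rows : ∀ (φ : Formula Qs p q) {x} f n → f n ⊩ φ [ x ] → row (rows f) n ⊩ φ [ x ]
⊩-rows φ f n = ⊩-cong φ (row-rows f n)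

⊩-rows-cons : ∀ (φ : Formula Qs (suc p) q) {x} (t : ℕ → ℕ) (f : ℕ → Baire) n →
  let α = rows (λ n → cons (t n) (f n)) in
  n ≤ t n → f n ⊩ φ [ t n ◂ x ] →
  n ≤ head (row α n) × (tail (row α n) ⊩ φ [ head (row α n) ◂ x ])
⊩-rows-cons φ {x} t f n n≤t w =
  subst (n ≤_) (eq 0) n≤t ,
  subst (λ s → tail (row α n) ⊩ φ [ s ◂ x ]) (eq 0) (⊩-cong φ (λ j → eq (suc j)) w)
  where
  α  = rows (λ n → cons (t n) (f n))
  eq = row-rows (λ n → cons (t n) (f n)) n

⊩⇒True : ∀ (φ : Formula Qs p q) {α x} → α ⊩ φ [ x ] → True φ x
⊩⇒True (matrix θ) (_ , true) = true
⊩⇒True (quant `∃ φ)  w   = _ , ⊩⇒True φ w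
⊩⇒True (quant `∀ φ)  w n = ⊩⇒True φ (w n)
⊩⇒True (quant `∃∞ φ) w n = _ , proj₁ (w n) , ⊩⇒True φ (proj₂ (w n))
⊩⇒True (quant `∀∞ φ) w   = _ , λ n t≤n → ⊩⇒True φ (w n t≤n)

-- Truth is a type of explicit choices, so the values to be put into the witness are at hand and no
-- choice principle is involved.
True⇒⊩ : ∀ (φ : Formula Qs p q) {x} → True φ x → ∃[ α ] α ⊩ φ [ x ]
True⇒⊩ (matrix θ) {x} true = code x , (λ _ → refl) , true
True⇒⊩ (quant `∃ φ) (t , true) = let (α , w) = True⇒⊩ φ true in cons t α , w
True⇒⊩ (quant `∀ φ) true =
  rows (λ n → proj₁ (True⇒⊩ φ (true n))) ,
  λ n → ⊩-rows φ (λ n → proj₁ (True⇒⊩ φ (true n))) n (proj₂ (True⇒⊩ φ (true n)))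
True⇒⊩ (quant `∃∞ φ) {x} true =
  rows (λ n → cons (proj₁ (true n)) (proj₁ (sub n))) ,
  λ n → ⊩-rows-cons φ (λ n → proj₁ (true n)) (λ n → proj₁ (sub n)) n
                    (proj₁ (proj₂ (true n))) (proj₂ (sub n))
  where
  sub : ∀ n → ∃[ α ] α ⊩ φ [ proj₁ (true n) ◂ x ]
  sub n = True⇒⊩ φ (proj₂ (proj₂ (true n)))
True⇒⊩ (quant `∀∞ φ) {x} (t , true) =
  cons t (rows (λ n → proj₁ (sub n))) ,
  λ n t≤n → ⊩-rows φ (λ n → proj₁ (sub n)) n (proj₂ (sub n) t≤n)
  where
  sub : ∀ n → ∃[ α ] (t ≤ n → α ⊩ φ [ n ◂ x ])
  sub n with t ≤? n
  ... | yes t≤n = let (α , w) = True⇒⊩ φ (true n t≤n) in α , λ _ → w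
  -- Nothing is required of the rows below the threshold, so any function will do.
  ... | no  t≰n = (λ _ → 0) , λ t≤n → contradiction t≤n t≰n

-- Strategies and the construction of reductions.

-- Computable recipes for witnesses. The arguments of the functionals are the
-- values of the enclosing quantifiers, the innermost one first; for ∃∞ they are
-- preceded by the lower bound that is asked for.

data Strategy (k : ℕ) : Pattern → ℕ → Set where
  done : Strategy k [] n
  `∃   : Functional k n → Strategy k Qs (suc n) → Strategy k (`∃ ∷ Qs) n
  `∀   : Strategy k Qs (suc n) → Strategy k (`∀ ∷ Qs) n
  `∃∞  : Functional k (suc n) → Strategy k Qs (suc n) → Strategy k (`∃∞ ∷ Qs) n
  `∀∞  : Functional k n → Strategy k Qs (suc n) → Strategy k (`∀∞ ∷ Qs) n

-- Only the numerical moves matter here; the copies of the instance at the leaves of a witness are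
-- added by `witnessᶠ`.
Winning : Strategy k Qs n → Vec Baire k → Vec ℕ n →
          Formula Qs (n + p) q → Instance p q → Set
Winning done      αs xs (matrix θ)     x = ⟦ θ ⟧ᵇ (xs ◂◂ x)
Winning (`∃ E σ)  αs xs (quant _ φ) x = Winning σ αs (eval E αs xs ∷ xs) φ x
Winning (`∀ σ)    αs xs (quant _ φ) x = ∀ n → Winning σ αs (n ∷ xs) φ x
Winning (`∃∞ K σ) αs xs (quant _ φ) x = ∀ n →
  n ≤ eval K αs (n ∷ xs) × Winning σ αs (eval K αs (n ∷ xs) ∷ xs) φ x
Winning (`∀∞ T σ) αs xs (quant _ φ) x = ∀ n →
  eval T αs xs ≤ n → Winning σ αs (n ∷ xs) φ x

leafᶠ : ∀ n → Functional k 1 → Functional k (suc n)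
leafᶠ zero    L = L
leafᶠ (suc n) L = consᶠ (varᶠ 0F) (skipᶠ (leafᶠ n L))

choiceᶠ : Functional k n → Functional k (2 + n) → Functional k (suc n)
choiceᶠ E F = reimplements
  (callᶠ F (varᶠ 0F ∷ callᶠ E (tabulate (λ i → varᶠ (suc i))) ∷ tabulate (λ i → varᶠ (suc i))))
  (λ { αs (j ∷ xs) → eval F αs (j ∷ eval E αs xs ∷ xs) })
  (λ { αs (j ∷ xs) → cong (λ ys → eval F αs (j ∷ eval E αs ys ∷ ys))
                          (evals-tabulate suc αs (j ∷ xs) xs (λ _ → refl)) })

-- In a row for `∃∞` the number of the row is merely the lower bound asked for. The continuation
-- sees the value chosen in response to it instead.
responseᶠ : Functional k (suc n) → Functional k (2 + n) → Functional k (2 + n)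
responseᶠ K F = reimplements
  (callᶠ F (varᶠ 0F ∷ callᶠ K (tabulate (λ i → varᶠ (suc i))) ∷ tabulate (λ i → varᶠ (suc (suc i)))))
  (λ { αs (j ∷ m ∷ xs) → eval F αs (j ∷ eval K αs (m ∷ xs) ∷ xs) })
  (λ { αs (j ∷ m ∷ xs) → cong₂ (λ ys zs → eval F αs (j ∷ eval K αs ys ∷ zs))
    (evals-tabulate suc αs (j ∷ m ∷ xs) (m ∷ xs) (λ _ → refl))
    (evals-tabulate (λ i → suc (suc i)) αs (j ∷ m ∷ xs) xs (λ _ → refl)) })

-- The functional `L` supplies the code of the instance without quantified variables, which ends up
-- at each leaf.
witnessᶠ : Strategy k Qs n → Functional k 1 → Functional k (suc n)
witnessᶠ done      L = leafᶠ _ L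
witnessᶠ (`∃ E σ)  L = consᶠ E (choiceᶠ E (witnessᶠ σ L))
witnessᶠ (`∀ σ)    L = unrowᶠ (witnessᶠ σ L)
witnessᶠ (`∃∞ K σ) L = unrowᶠ (consᶠ K (responseᶠ K (witnessᶠ σ L)))
witnessᶠ (`∀∞ T σ) L = consᶠ T (unrowᶠ (witnessᶠ σ L))

leafᶠ-code : ∀ (L : Functional k 1) αs (x : Instance p q) → function L αs ≗ code x →
             ∀ (xs : Vec ℕ n) j → eval (leafᶠ n L) αs (j ∷ xs) ≡ code (xs ◂◂ x) j
leafᶠ-code L αs x eq []       j       = eq j
leafᶠ-code L αs x eq (_ ∷ xs) zero    = refl
leafᶠ-code L αs x eq (_ ∷ xs) (suc j) = leafᶠ-code L αs x eq xs j

witnessᶠ-⊩ : ∀ (σ : Strategy k Qs n) L αs xs φ (x : Instance p q) → function L αs ≗ code x →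
             Winning σ αs xs φ x → (λ j → eval (witnessᶠ σ L) αs (j ∷ xs)) ⊩ φ [ xs ◂◂ x ]
witnessᶠ-⊩ done L αs xs (matrix θ) x eq w = leafᶠ-code L αs x eq xs , w
witnessᶠ-⊩ (`∃ E σ) L αs xs (quant _ φ) x eq w = witnessᶠ-⊩ σ L αs _ φ x eq w
witnessᶠ-⊩ (`∀ σ) L αs xs (quant _ φ) x eq w n =
  ⊩-rows φ (λ n j → eval (witnessᶠ σ L) αs (j ∷ n ∷ xs)) n
         (witnessᶠ-⊩ σ L αs _ φ x eq (w n))
witnessᶠ-⊩ (`∃∞ K σ) L αs xs (quant _ φ) x eq w n =
  ⊩-rows-cons φ (λ m → eval K αs (m ∷ xs))
    (λ m j → eval (witnessᶠ σ L) αs (j ∷ eval K αs (m ∷ xs) ∷ xs)) n (proj₁ (w n))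
    (witnessᶠ-⊩ σ L αs _ φ x eq (proj₂ (w n)))
witnessᶠ-⊩ (`∀∞ T σ) L αs xs (quant _ φ) x eq w n t≤n =
  ⊩-rows φ (λ n j → eval (witnessᶠ σ L) αs (j ∷ n ∷ xs)) n
         (witnessᶠ-⊩ σ L αs _ φ x eq (w n t≤n))

-- Leaves only the mathematical content of a reduction: a computable target and a winning strategy
-- for each direction. Since `η` is given, the dual reduction can share it.
reduction : ∀ {A : Problem p q} {B : Problem p′ q′} (η : Functional 1 1)
  (target : Instance p q → Instance p′ q′)
  (σ₋ : Strategy 2 (Problem.pattern′ B) 0) (σ₊ : Strategy 2 (Problem.pattern′ A) 0) →
  (∀ x → IsInstance A x → IsInstance B (target x)) →
  (∀ x → IsInstance A x → function η (code x ∷ []) ≗ code (target x)) →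
  (∀ x → IsInstance A x → ∀ α → α ⊩ formula A [ x ] →
    Winning σ₋ (α ∷ code x ∷ []) [] (formula B) (target x)) →
  (∀ x → IsInstance A x → ∀ α → α ⊩ formula B [ target x ] →
    Winning σ₊ (α ∷ code x ∷ []) [] (formula A) x) →
  Reduction (programOf η) A B
reduction {A = A} {B} η target σ₋ σ₊ inst-target η-target win₋ win₊ =
  programOf₂ r₋ , programOf₂ r₊ , λ x x∈A →
  let forward α w = function r₋ (α ∷ code x ∷ []) , programOf₂-computes r₋ ,
        witnessᶠ-⊩ σ₋ (shiftᶠ η) _ [] (formula B) (target x) (η-target x x∈A) (win₋ x x∈A α w)
      backward α w = function r₊ (α ∷ code x ∷ []) , programOf₂-computes r₊ ,
        witnessᶠ-⊩ σ₊ (oracleᶠ 1F (varᶠ 0F)) _ [] (formula A) x (λ _ → refl) (win₊ x x∈A α w)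
  in target x , inst-target x x∈A ,
     (λ j → subst (_ ⊢ _ · _ ↦_) (η-target x x∈A j) (programOf-computes η j)) ,
     -- A true formula has some witness, not necessarily computable, and its translation makes the
     -- other formula true.
     mk⇔ (λ true → let (α , w) = True⇒⊩ (formula A) true in
                   ⊩⇒True (formula B) (proj₂ (proj₂ (forward α w))))
         (λ true → let (α , w) = True⇒⊩ (formula B) true in
                   ⊩⇒True (formula A) (proj₂ (proj₂ (backward α w)))) ,
     forward , backward
  where
  r₋ = witnessᶠ σ₋ (shiftᶠ η)
  r₊ = witnessᶠ σ₊ (oracleᶠ 1F (varᶠ 0F))

-- Computability of instances and evaluation of terms on their codes.

computable-cons : ∀ t {α} → Computable α → Computable (cons t α)
computable-cons t (c , α-comp) =
  function-computable (consᶠ (litᶠ t) (oracleᶠ 0F (varᶠ 0F))) (c ∷ [] , α-comp ∷ [])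

computable-merge : ∀ (fs : Vec Baire q) → All Computable fs → Computable (merge fs)
computable-merge []           _ = function-computable (litᶠ 0) ([] , [])
computable-merge (f ∷ [])     (f-comp ∷ _) = f-comp
computable-merge (f ∷ g ∷ fs) ((c , f-comp) ∷ rest) =
  let (d , rest-comp) = computable-merge (g ∷ fs) rest in
  function-computable (joinᶠ (oracleᶠ 0F (varᶠ 0F)) (oracleᶠ 1F (varᶠ 0F)))
                      (c ∷ d ∷ [] , f-comp ∷ rest-comp ∷ [])

computable-code : ∀ (x : Instance p q) → ComputableInstance x → Computable (code x)
computable-code (inst [] fs)       comp = computable-merge fs comp
computable-code (inst (t ∷ ns) fs) comp = computable-cons t (computable-code (inst ns fs) comp)

functionOfCode-computable : ∀ (F : Functional 1 1) (x : Instance p q) →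
  ComputableInstance x → Computable (function F (code x ∷ []))
functionOfCode-computable F x comp =
  let (c , x-comp) = computable-code x comp in function-computable F (c ∷ [] , x-comp ∷ [])

-- Where the value at t of the i-th of several merged functions is found.
slot : Fin q → ℕ → ℕ
slot {suc zero}    0F      t = t
slot {suc (suc q)} 0F      t = double t
slot {suc (suc q)} (suc i) t = suc (double (slot i t))

merge-slot : ∀ (fs : Vec Baire q) i t → merge fs (slot i t) ≡ lookup fs i t
merge-slot (f ∷ [])     0F      t = refl
merge-slot (f ∷ g ∷ fs) 0F      t = join-double f _ t
merge-slot (f ∷ g ∷ fs) (suc i) t = trans (join-1+double f _ (slot i t)) (merge-slot (g ∷ fs) i t)

slotᶠ : Fin q → Functional k 1
slotᶠ i = reimplements (slots i) (λ { _ (t ∷ []) → slot i t }) (λ { αs (t ∷ []) → correct i αs t })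
  where
  slots : Fin q → Functional k 1
  slots {suc zero}    0F      = varᶠ 0F
  slots {suc (suc q)} 0F      = doubleᶠ (varᶠ 0F)
  slots {suc (suc q)} (suc i) = sucᶠ (doubleᶠ (slots i))

  correct : ∀ (i : Fin q) (αs : Vec Baire k) t → function (slots i) αs t ≡ slot i t
  correct {suc zero}    0F      αs t = refl
  correct {suc (suc q)} 0F      αs t = refl
  correct {suc (suc q)} (suc i) αs t = cong (λ j → suc (double j)) (correct i αs t)

code-nums : ∀ (x : Instance p q) i → code x (toℕ i) ≡ lookup (nums x) i
code-nums (inst (t ∷ ns) fs) 0F      = refl
code-nums (inst (t ∷ ns) fs) (suc i) = code-nums (inst ns fs) i

code-funs : ∀ (x : Instance p q) j → code x (p + j) ≡ merge (funs x) j
code-funs (inst [] fs)       j = refl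
code-funs (inst (t ∷ ns) fs) j = code-funs (inst ns fs) j

-- The first `n` variables are quantified and come as arguments. The other `p` stand at the
-- beginning of the code of the instance, and the merged functions follow from position `p` on.
termᶠ : ∀ n → Term (n + p) q → Functional 1 n
termᶠ n (var i)            = [ varᶠ , (λ j → oracleᶠ 0F (litᶠ (toℕ j))) ]′ (splitAt n i)
termᶠ {p = p} n (app i t)  = oracleᶠ 0F (litᶠ p +ᶠ call₁ (slotᶠ i) (termᶠ n t))
termᶠ n zeroᵗ              = litᶠ 0
termᶠ n (sucᵗ t)           = sucᶠ (termᶠ n t)
termᶠ n (s +ᵗ t)           = termᶠ n s +ᶠ termᶠ n t
termᶠ n (s *ᵗ t)           = termᶠ n s *ᶠ termᶠ n t
termᶠ n (pairᵗ s t)        = pairᶠ (termᶠ n s) (termᶠ n t)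
termᶠ n (fstᵗ t)           = fstᶠ (termᶠ n t)
termᶠ n (sndᵗ t)           = sndᶠ (termᶠ n t)

termᶠ-correct : ∀ (x : Instance p q) (xs : Vec ℕ n) t →
  eval (termᶠ n t) (code x ∷ []) xs ≡ ⟦ t ⟧ᵗ (xs ◂◂ x)
termᶠ-correct {n = n} x xs (var i) rewrite lookup-splitAt n xs (nums x) i with splitAt n i
... | inj₁ i = refl
... | inj₂ j = code-nums x j
termᶠ-correct x xs (app i t) rewrite sym (termᶠ-correct x xs t) =
  trans (code-funs x _) (merge-slot (funs x) i _)
termᶠ-correct x xs zeroᵗ       = refl
termᶠ-correct x xs (sucᵗ t)    = cong suc (termᶠ-correct x xs t)
termᶠ-correct x xs (s +ᵗ t)    = cong₂ _+_ (termᶠ-correct x xs s) (termᶠ-correct x xs t)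
termᶠ-correct x xs (s *ᵗ t)    = cong₂ _*_ (termᶠ-correct x xs s) (termᶠ-correct x xs t)
termᶠ-correct x xs (pairᵗ s t) = cong₂ pair (termᶠ-correct x xs s) (termᶠ-correct x xs t)
termᶠ-correct x xs (fstᵗ t)    = cong fst (termᶠ-correct x xs t)
termᶠ-correct x xs (sndᵗ t)    = cong snd (termᶠ-correct x xs t)

-- Primitive recursive tests for bounded formulas.

∑<≡0⇒ : ∀ t {f} → ∑< t f ≡ 0 → ∀ i → i < t → f i ≡ 0
∑<≡0⇒ (suc t) {f} eq i (s≤s i≤t) with i ≟ t
... | yes refl = m+n≡0⇒m≡0 (f i) eq
... | no  i≢t  = ∑<≡0⇒ t (m+n≡0⇒n≡0 (f t) eq) i (≤∧≢⇒< i≤t i≢t)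

⇒∑<≡0 : ∀ t {f} → (∀ i → i < t → f i ≡ 0) → ∑< t f ≡ 0
⇒∑<≡0 zero    eq = refl
⇒∑<≡0 (suc t) eq = cong₂ _+_ (eq t ≤-refl) (⇒∑<≡0 t (λ i i<t → eq i (m<n⇒m<1+n i<t)))

∏<≡0⇒ : ∀ t {f} → ∏< t f ≡ 0 → ∃[ i ] i < t × f i ≡ 0
∏<≡0⇒ (suc t) {f} eq with m*n≡0⇒m≡0∨n≡0 (f t) eq
... | inj₁ ft≡0 = t , ≤-refl , ft≡0
... | inj₂ rest = let (i , i<t , fi≡0) = ∏<≡0⇒ t rest in i , m<n⇒m<1+n i<t , fi≡0

⇒∏<≡0 : ∀ t {f} i → i < t → f i ≡ 0 → ∏< t f ≡ 0
⇒∏<≡0 (suc t) {f} i (s≤s i≤t) fi≡0 with i ≟ t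
... | yes refl = cong (_* ∏< t f) fi≡0
... | no  i≢t  = trans (cong (f t *_) (⇒∏<≡0 t i (≤∧≢⇒< i≤t i≢t) fi≡0)) (*-zeroʳ (f t))

1∸m≡0⇒m≢0 : ∀ {m} → 1 ∸ m ≡ 0 → m ≢ 0
1∸m≡0⇒m≢0 {suc m} _ ()

m≢0⇒1∸m≡0 : ∀ {m} → m ≢ 0 → 1 ∸ m ≡ 0
m≢0⇒1∸m≡0 {zero}  m≢0 = contradiction refl m≢0
m≢0⇒1∸m≡0 {suc m} _   = 0∸n≡0 m

-- The value of testᶠ n θ is 0 exactly when θ holds.
testᶠ : ∀ n → Bounded (n + p) q → Functional 1 n
testᶠ n (s ≐ t)    = (termᶠ n s ∸ᶠ termᶠ n t) +ᶠ (termᶠ n t ∸ᶠ termᶠ n s)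
testᶠ n (s ≤ᵇ t)   = termᶠ n s ∸ᶠ termᶠ n t
testᶠ n (¬ᵇ θ)     = litᶠ 1 ∸ᶠ testᶠ n θ
testᶠ n (θ ∧ᵇ ξ)   = testᶠ n θ +ᶠ testᶠ n ξ
testᶠ n (θ ∨ᵇ ξ)   = testᶠ n θ *ᶠ testᶠ n ξ
testᶠ n (θ ⇒ᵇ ξ)   = (litᶠ 1 ∸ᶠ testᶠ n θ) *ᶠ testᶠ n ξ
testᶠ n (∀< t ∙ θ) = letᶠ (termᶠ n t) (∑ᶠ (testᶠ (suc n) θ))
testᶠ n (∃< t ∙ θ) = letᶠ (termᶠ n t) (∏ᶠ (testᶠ (suc n) θ))

-- By simultaneous induction with the converse, because negation and the premise of an implication
-- exchange the two directions.
testᶠ≡0⇒ : ∀ (x : Instance p q) (xs : Vec ℕ n) θ →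
  eval (testᶠ n θ) (code x ∷ []) xs ≡ 0 → ⟦ θ ⟧ᵇ (xs ◂◂ x)
⇒testᶠ≡0 : ∀ (x : Instance p q) (xs : Vec ℕ n) θ →
  ⟦ θ ⟧ᵇ (xs ◂◂ x) → eval (testᶠ n θ) (code x ∷ []) xs ≡ 0

testᶠ≡0⇒ {n = n} x xs (s ≐ t) eq
  rewrite sym (termᶠ-correct x xs s) | sym (termᶠ-correct x xs t) =
  ≤-antisym (m∸n≡0⇒m≤n (m+n≡0⇒m≡0 _ eq))
    (m∸n≡0⇒m≤n (m+n≡0⇒n≡0 (eval (termᶠ n s) _ xs ∸ eval (termᶠ n t) _ xs) eq))
testᶠ≡0⇒ x xs (s ≤ᵇ t) eq
  rewrite sym (termᶠ-correct x xs s) | sym (termᶠ-correct x xs t) = m∸n≡0⇒m≤n eq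
testᶠ≡0⇒ x xs (¬ᵇ θ) eq true = 1∸m≡0⇒m≢0 eq (⇒testᶠ≡0 x xs θ true)
testᶠ≡0⇒ {n = n} x xs (θ ∧ᵇ ξ) eq =
  testᶠ≡0⇒ x xs θ (m+n≡0⇒m≡0 _ eq) ,
  testᶠ≡0⇒ x xs ξ (m+n≡0⇒n≡0 (eval (testᶠ n θ) _ xs) eq)
testᶠ≡0⇒ {n = n} x xs (θ ∨ᵇ ξ) eq with m*n≡0⇒m≡0∨n≡0 (eval (testᶠ n θ) _ xs) eq
... | inj₁ eq = inj₁ (testᶠ≡0⇒ x xs θ eq)
... | inj₂ eq = inj₂ (testᶠ≡0⇒ x xs ξ eq)
testᶠ≡0⇒ {n = n} x xs (θ ⇒ᵇ ξ) eq true with m*n≡0⇒m≡0∨n≡0 (1 ∸ eval (testᶠ n θ) _ xs) eq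
... | inj₁ eq = contradiction (⇒testᶠ≡0 x xs θ true) (1∸m≡0⇒m≢0 eq)
... | inj₂ eq = testᶠ≡0⇒ x xs ξ eq
testᶠ≡0⇒ x xs (∀< t ∙ θ) eq i i<t rewrite sym (termᶠ-correct x xs t) =
  testᶠ≡0⇒ x (i ∷ xs) θ (∑<≡0⇒ _ eq i i<t)
testᶠ≡0⇒ x xs (∃< t ∙ θ) eq rewrite sym (termᶠ-correct x xs t) =
  let (i , i<t , eq) = ∏<≡0⇒ _ eq in i , i<t , testᶠ≡0⇒ x (i ∷ xs) θ eq

⇒testᶠ≡0 {n = n} x xs (s ≐ t) eq
  rewrite sym (termᶠ-correct x xs s) | sym (termᶠ-correct x xs t) =
  cong₂ _+_ (m≤n⇒m∸n≡0 (≤-reflexive eq)) (m≤n⇒m∸n≡0 (≤-reflexive (sym eq)))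
⇒testᶠ≡0 x xs (s ≤ᵇ t) s≤t
  rewrite sym (termᶠ-correct x xs s) | sym (termᶠ-correct x xs t) = m≤n⇒m∸n≡0 s≤t
⇒testᶠ≡0 x xs (¬ᵇ θ) false = m≢0⇒1∸m≡0 (λ eq → false (testᶠ≡0⇒ x xs θ eq))
⇒testᶠ≡0 x xs (θ ∧ᵇ ξ) (trueˡ , trueʳ) =
  cong₂ _+_ (⇒testᶠ≡0 x xs θ trueˡ) (⇒testᶠ≡0 x xs ξ trueʳ)
⇒testᶠ≡0 {n = n} x xs (θ ∨ᵇ ξ) (inj₁ true) =
  cong (_* eval (testᶠ n ξ) _ xs) (⇒testᶠ≡0 x xs θ true)
⇒testᶠ≡0 {n = n} x xs (θ ∨ᵇ ξ) (inj₂ true) =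
  trans (cong (eval (testᶠ n θ) _ xs *_) (⇒testᶠ≡0 x xs ξ true)) (*-zeroʳ (eval (testᶠ n θ) _ xs))
⇒testᶠ≡0 {n = n} x xs (θ ⇒ᵇ ξ) true with eval (testᶠ n θ) (code x ∷ []) xs in eq
... | zero  = trans (+-identityʳ _) (⇒testᶠ≡0 x xs ξ (true (testᶠ≡0⇒ x xs θ eq)))
... | suc v = cong (_* eval (testᶠ n ξ) (code x ∷ []) xs) (0∸n≡0 v)
⇒testᶠ≡0 x xs (∀< t ∙ θ) true rewrite sym (termᶠ-correct x xs t) =
  ⇒∑<≡0 _ (λ i i<t → ⇒testᶠ≡0 x (i ∷ xs) θ (true i i<t))
⇒testᶠ≡0 x xs (∃< t ∙ θ) (i , i<t , true) rewrite sym (termᶠ-correct x xs t) =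
  ⇒∏<≡0 _ i i<t (⇒testᶠ≡0 x (i ∷ xs) θ true)

-- The complete formula.

eventuallyZero : Formula (`∀ ∷ `∀∞ ∷ []) 0 1
eventuallyZero = quant `∀ (quant `∀∞ (matrix (app 0F (pairᵗ (var 1F) (var 0F)) ≐ zeroᵗ)))

unrowᶠ-pair : ∀ (F : Functional k 2) αs n m →
  function (unrowᶠ F) αs (pair n m) ≡ eval F αs (m ∷ n ∷ [])
unrowᶠ-pair F αs n m rewrite unpair-pair n m = refl

eventuallyZero-strictlyDicomplete : StrictlyDicomplete eventuallyZero
eventuallyZero-strictlyDicomplete {p} {q} ψ@(quant _ (quant _ (matrix θ))) =
  programOf η ,
  reduction {A = unrestricted ψ} {B = unrestricted eventuallyZero} η target keepBound keepBound
    target-isInstance (λ _ _ _ → refl)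
    (λ x _ α w n m t≤m → trans (unrowᶠ-pair (testᶠ 2 θ) _ n m)
       (⇒testᶠ≡0 x (m ∷ n ∷ []) θ (proj₂ (w n m t≤m))))
    (λ x _ α w n m t≤m → testᶠ≡0⇒ x (m ∷ n ∷ []) θ
       (trans (sym (unrowᶠ-pair (testᶠ 2 θ) _ n m)) (proj₂ (w n m t≤m)))) ,
  reduction {A = dual (unrestricted ψ)} {B = dual (unrestricted eventuallyZero)} η target
    keepValues keepValues target-isInstance (λ _ _ _ → refl)
    (λ x _ α w m → proj₁ (w m) , λ eq → proj₂ (proj₂ (w m))
       (testᶠ≡0⇒ x (_ ∷ _ ∷ []) θ (trans (sym (unrowᶠ-pair (testᶠ 2 θ) _ _ _)) eq)))
    (λ x _ α w m → proj₁ (w m) , λ true → proj₂ (proj₂ (w m))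
       (trans (unrowᶠ-pair (testᶠ 2 θ) _ _ _) (⇒testᶠ≡0 x (_ ∷ _ ∷ []) θ true)))
  where
  η = unrowᶠ (testᶠ 2 θ)

  target : Instance p q → Instance 0 1
  target x = inst [] (function η (code x ∷ []) ∷ [])

  target-isInstance : ∀ x → ComputableInstance x × _ → ComputableInstance (target x) × _
  target-isInstance x (comp , _) = functionOfCode-computable η x comp ∷ [] , _

  -- The bound for n is the head of the n-th row of the witness, at position ⟨n,0⟩. In the dual, the
  -- value of `∃` occupies position 0 and shifts the rows by one.
  keepBound : Strategy 2 (`∀ ∷ `∀∞ ∷ []) 0
  keepBound = `∀ (`∀∞ (oracleᶠ 0F (pairᶠ (varᶠ 0F) (litᶠ 0))) done)

  keepValues : Strategy 2 (`∃ ∷ `∃∞ ∷ []) 0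
  keepValues = `∃ (oracleᶠ 0F (litᶠ 0))
                  (`∃∞ (oracleᶠ 0F (sucᶠ (pairᶠ (varᶠ 0F) (litᶠ 0)))) done)

-- Bounded search and guessing in the limit.

search : (ℕ → ℕ) → ℕ → ℕ → ℕ
search f s = natRec s (λ _ j → ifZero (f j) (suc j) j)

start≤search : ∀ f s N → s ≤ search f s N
start≤search f s zero = ≤-refl
start≤search f s (suc N) with f (search f s N)
... | zero  = m≤n⇒m≤1+n (start≤search f s N)
... | suc _ = start≤search f s N

-- With `N` steps the arguments from `s` up to but excluding `s + N` are tested; a search that fails
-- on all of them ends at the untested `s + N`.
search-spec : ∀ f s N → f (search f s N) ≢ 0 ⊎
                        (search f s N ≡ s + N × (∀ j → j < N → f (s + j) ≡ 0))
search-spec f s zero = inj₂ (sym (+-identityʳ s) , λ _ ())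
search-spec f s (suc N) with f (search f s N) in eq | search-spec f s N
... | suc _ | _              = inj₁ λ eq′ → 1+n≢0 (trans (sym eq) eq′)
... | zero  | inj₁ found     = contradiction refl found
... | zero  | inj₂ (end , none) = inj₂ (trans (cong suc end) (sym (+-suc s N)) , none′)
  where
  none′ : ∀ j → j < suc N → f (s + j) ≡ 0
  none′ j (s≤s j≤N) with j ≟ N
  ... | yes refl = trans (cong f (sym end)) eq
  ... | no  j≢N  = none j (≤∧≢⇒< j≤N j≢N)

search-finds : ∀ f s N i → i < N → f (s + i) ≢ 0 → f (search f s N) ≢ 0
search-finds f s N i i<N fi≢0 with search-spec f s N
... | inj₁ found      = found
... | inj₂ (_ , none) = contradiction (none i i<N) fi≢0

searchᶠ : Functional k (suc n) → Functional k (2 + n)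
searchᶠ F = reimplements
  (recᶠ (varᶠ 0F)
    (ifZeroᶠ (callᶠ F (varᶠ 1F ∷ tabulate (λ i → varᶠ (suc (suc (suc i))))))
             (sucᶠ (varᶠ 1F)) (varᶠ 1F)))
  (λ { αs (N ∷ s ∷ xs) → search (λ j → eval F αs (j ∷ xs)) s N })
  (λ { αs (N ∷ s ∷ xs) → correct αs xs s N })
  where
  args : ∀ {n} → Vec (Functional _ (3 + n)) n
  args = tabulate (λ i → varᶠ (suc (suc (suc i))))

  correct : ∀ αs xs s N →
    natRec s (λ i j → ifZero (eval F αs (j ∷ evals args αs (i ∷ j ∷ s ∷ xs))) (suc j) j) N ≡
    search (λ j → eval F αs (j ∷ xs)) s N
  correct αs xs s zero    = refl
  correct αs xs s (suc N)
    rewrite correct αs xs s N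
          | evals-tabulate (λ i → suc (suc (suc i))) αs
              (N ∷ search (λ j → eval F αs (j ∷ xs)) s N ∷ s ∷ xs) xs (λ _ → refl) = refl

-- Guessing in the limit a number v such that r v e is 0 for all e.
module Guessing (r : ℕ → ℕ → ℕ) where

  refutations : ℕ → ℕ → ℕ
  refutations v m = ∑< (suc m) (r v)

  candidate : ℕ → ℕ
  candidate = natRec 0 (λ m v → ifZero (refutations v m) v (suc v))

  movement : ℕ → ℕ
  movement m = refutations (candidate m) m

  refuted : ∀ t v → ∑< t (r v) ≢ 0 → ∃[ e ] e < t × r v e ≢ 0
  refuted zero    v ≢0 = contradiction refl ≢0
  refuted (suc t) v ≢0 with r v t ≟ 0
  ... | no  rt≢0 = t , ≤-refl , rt≢0
  ... | yes rt≡0 =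
    let (e , e<t , re≢0) = refuted t v (λ ≡0 → ≢0 (cong₂ _+_ rt≡0 ≡0))
    in e , m<n⇒m<1+n e<t , re≢0

  unmoved⇒unrefuted : ∀ m → movement m ≡ 0 → ∀ e → e ≤ m → r (candidate m) e ≡ 0
  unmoved⇒unrefuted m eq e e≤m = ∑<≡0⇒ (suc m) eq e (s≤s e≤m)

  candidate-stays : ∀ m → movement m ≡ 0 → candidate (suc m) ≡ candidate m
  candidate-stays m eq rewrite eq = refl

  candidate-moves : ∀ m → movement m ≢ 0 → candidate (suc m) ≡ suc (candidate m)
  candidate-moves m ≢0 = ifZero-pos (n≢0⇒n>0 ≢0)

  candidate-step : ∀ m → candidate m ≤ candidate (suc m)
  candidate-step m with movement m ≟ 0
  ... | yes eq = ≤-reflexive (sym (candidate-stays m eq))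
  ... | no  ≢0 = ≤-trans (n≤1+n _) (≤-reflexive (sym (candidate-moves m ≢0)))

  candidate-mono : ∀ {m m′} → m ≤ m′ → candidate m ≤ candidate m′
  candidate-mono m≤m′ = mono (≤⇒≤′ m≤m′)
    where
    mono : ∀ {m m′} → m ≤′ m′ → candidate m ≤ candidate m′
    mono ≤′-refl       = ≤-refl
    mono (≤′-step m≤m′) = ≤-trans (mono m≤m′) (candidate-step _)

  candidate-constant : ∀ m j → (∀ i → i < j → movement (m + i) ≡ 0) →
                       candidate (m + j) ≡ candidate m
  candidate-constant m zero    still = cong candidate (+-identityʳ m)
  candidate-constant m (suc j) still = trans (cong candidate (+-suc m j))
    (trans (candidate-stays (m + j) (still j ≤-refl))
           (candidate-constant m j (λ i i<j → still i (m<n⇒m<1+n i<j))))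

  -- Candidates advance one at a time, so every smaller number was once the candidate and was left
  -- at an earlier stage, because of some e up to that stage.
  below-candidate-refuted : ∀ m v → v < candidate m → ∃[ e ] e < m × r v e ≢ 0
  below-candidate-refuted (suc m) v v< with v <? candidate m
  ... | yes v<′ = let (e , e<m , re≢0) = below-candidate-refuted m v v<′ in
                  e , m<n⇒m<1+n e<m , re≢0
  ... | no  v≮ with movement m ≟ 0
  ...   | yes eq = contradiction (subst (v <_) (candidate-stays m eq) v<) v≮
  ...   | no  ≢0 with ≤-antisym (≮⇒≥ v≮) (≤-pred (subst (v <_) (candidate-moves m ≢0) v<))
  ...     | refl = refuted (suc m) v ≢0

  -- At stage `t + e` the candidate is still that of stage `t`, and it is tested against `e` there.
  settled⇒unrefuted : ∀ t → (∀ m → t ≤ m → movement m ≡ 0) → ∀ e → r (candidate t) e ≡ 0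
  settled⇒unrefuted t still e =
    trans (cong (λ v → r v e) (sym (candidate-constant t e (λ i _ → still (t + i) (m≤m+n t i)))))
          (unmoved⇒unrefuted (t + e) (still (t + e) (m≤m+n t e)) e (m≤n+m e t))

  -- From b on the candidate grows at every step until it reaches v.
  settles : ∀ v b → (∀ e → r v e ≡ 0) → (∀ v′ → (∀ e → e ≤ b → r v′ e ≡ 0) → v′ ≡ v) →
            ∀ m → b + v ≤ m → movement m ≡ 0
  settles v b correct unique m b+v≤m =
    ⇒∑<≡0 (suc m) (λ e _ → trans (cong (λ v → r v e) arrived) (correct e))
    where
    -- Candidates are left only when refuted, and `v` never is.
    candidate≤v : ∀ m → candidate m ≤ v
    candidate≤v m with candidate m ≤? v
    ... | yes ≤v = ≤v
    ... | no  ≰v = let (e , _ , re≢0) = below-candidate-refuted m v (≰⇒> ≰v) in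
                   contradiction (correct e) re≢0

    grows : ∀ j → candidate (b + j) ≡ v ⊎ j ≤ candidate (b + j)
    grows zero = inj₂ z≤n
    grows (suc j) rewrite +-suc b j with movement (b + j) ≟ 0
    -- A candidate that does not move at a stage from `b` on has passed all tests up to `b`, so it
    -- is `v` by uniqueness.
    ... | yes eq = inj₁ (trans (candidate-stays (b + j) eq)
      (unique _ (λ e e≤b → unmoved⇒unrefuted (b + j) eq e (≤-trans e≤b (m≤m+n b j)))))
    ... | no  ≢0 with grows j
    ...   | inj₂ j≤ = inj₂ (subst (suc j ≤_) (sym (candidate-moves (b + j) ≢0)) (s≤s j≤))
    ...   | inj₁ ≡v = let (e , _ , re≢0) = refuted (suc (b + j)) (candidate (b + j)) ≢0 in
                      contradiction (trans (cong (λ v → r v e) ≡v) (correct e)) re≢0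

    arrived : candidate m ≡ v
    arrived with grows (m ∸ b)
    ... | inj₁ ≡v rewrite m+[n∸m]≡n (≤-trans (m≤m+n b v) b+v≤m) = ≡v
    -- Here the candidate has grown to at least `m ∸ b`, which is at least `v`.
    ... | inj₂ ≥  rewrite m+[n∸m]≡n (≤-trans (m≤m+n b v) b+v≤m) =
      ≤-antisym (candidate≤v m)
        (≤-trans (≤-trans (≤-reflexive (sym (m+n∸m≡n b v))) (∸-monoˡ-≤ b b+v≤m)) ≥)

  -- If nothing moved from stage `m` to stage `m + e`, the candidate of stage `m` would pass the
  -- test at `e`. These are `suc e` stages.
  moves-when-refuted : ∀ m e → r (candidate m) e ≢ 0 → movement (search movement m (suc e)) ≢ 0
  moves-when-refuted m e re≢0 with search-spec movement m (suc e)
  ... | inj₁ found      = found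
  ... | inj₂ (_ , none) = contradiction
    (trans (cong (λ v → r v e) (sym (candidate-constant m e (λ i i<e → none i (m<n⇒m<1+n i<e)))))
           (unmoved⇒unrefuted (m + e) (none e ≤-refl) e (m≤n+m e m)))
    re≢0

  module _ (g : ℕ → ℕ) (m≤g : ∀ m → m ≤ g m) (g-moves : ∀ m → movement (g m) ≢ 0) where

    -- Asking for each movement strictly after the previous one makes the movements distinct, so
    -- that `suc v` of them have taken place by the end of stage `moment v`.
    moment : ℕ → ℕ
    moment = natRec (g 0) (λ _ m → g (suc m))

    moment-passes : ∀ v → v < candidate (suc (moment v))
    moment-passes zero    = subst (0 <_) (sym (candidate-moves _ (g-moves 0))) (s≤s z≤n)
    moment-passes (suc v) = subst (suc v <_) (sym (candidate-moves _ (g-moves _)))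
      (s≤s (≤-trans (moment-passes v) (candidate-mono (m≤g _))))

    -- The candidate has passed `v` by then, so a refutation of `v` exists below a known bound and
    -- is found by bounded search.
    moment-refutes : ∀ v → r v (search (r v) 0 (suc (moment v))) ≢ 0
    moment-refutes v =
      let (e , e<m , re≢0) = below-candidate-refuted _ v (moment-passes v) in
      search-finds (r v) 0 _ e e<m re≢0

-- Reduction of `Lattice` to `eventuallyZero`.

matrix₃ : ∀ {Q₁ Q₂ Q₃} → Formula (Q₁ ∷ Q₂ ∷ Q₃ ∷ []) p q → Bounded (3 + p) q
matrix₃ (quant _ (quant _ (quant _ (matrix θ)))) = θ

-- For u = ⟨a,b⟩ and v = ⟨c,d⟩: e does not refute that c is the meet and d the
-- join of a and b.
Verified : Instance 0 2 → ℕ → ℕ → ℕ → Set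
Verified x u v e = ⟦ matrix₃ latticeFormula ⟧ᵇ ((e ∷ v ∷ u ∷ []) ◂◂ x)

-- Two tests of v′ suffice. The one at c yields c ≤ c′ and the one at d yields d′ ≤ d; the converse
-- inequalities come from the correctness of v.
meetJoin-unique : ∀ {χ ρ} → IsPosetCode χ ρ → let x = inst [] (χ ∷ ρ ∷ []) in
  ∀ u v v′ → χ (fst u) ≡ 1 → χ (snd u) ≡ 1 → (∀ e → Verified x u v e) →
  Verified x u v′ (fst v) → Verified x u v′ (snd v) → v′ ≡ v
meetJoin-unique {χ} {ρ} P u v v′ χa χb ver ver′c ver′d =
  -- That c and d belong to the poset does not depend on e, so 0 is as good as any value.
  let c∈ , d∈ = proj₁ (ver 0 (χa , χb))
      (c≤a , c≤b , _ , _)     , _      , _ = proj₂ (ver (fst v) (χa , χb)) c∈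
      (_ , _ , a≤d , b≤d)     , _      , _ = proj₂ (ver (snd v) (χa , χb)) d∈
      (c′∈ , d′∈) , at-c = ver′c (χa , χb)
      (c′≤a , c′≤b , a≤d′ , b≤d′) , glb′ , _ = at-c c∈
      _ , _ , lub′ = proj₂ (ver′d (χa , χb)) d∈
      _ , glb , _ = proj₂ (ver (fst v′) (χa , χb)) c′∈
      _ , _ , lub = proj₂ (ver (snd v′) (χa , χb)) d′∈
      c′≡c = antisym {_ , c′∈} {_ , c∈} (glb (c′≤a , c′≤b)) (glb′ (c≤a , c≤b))
      d′≡d = antisym {_ , d′∈} {_ , d∈} (lub′ (a≤d , b≤d)) (lub (a≤d′ , b≤d′))
  in trans (sym (pair-unpair v′)) (trans (cong₂ pair c′≡c d′≡d) (pair-unpair v))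
  where open IsPartialOrder (IsPosetCode.isPartialOrder P) using (antisym)

abstract
  verifyᶠ : Functional 1 3
  verifyᶠ = testᶠ 3 (matrix₃ latticeFormula)

  verifyᶠ≡0⇒ : ∀ x u v e → eval verifyᶠ (code x ∷ []) (e ∷ v ∷ u ∷ []) ≡ 0 → Verified x u v e
  verifyᶠ≡0⇒ x u v e = testᶠ≡0⇒ x (e ∷ v ∷ u ∷ []) (matrix₃ latticeFormula)

  ⇒verifyᶠ≡0 : ∀ x u v e → Verified x u v e → eval verifyᶠ (code x ∷ []) (e ∷ v ∷ u ∷ []) ≡ 0
  ⇒verifyᶠ≡0 x u v e = ⇒testᶠ≡0 x (e ∷ v ∷ u ∷ []) (matrix₃ latticeFormula)

refutationsᶠ : Functional 1 3
refutationsᶠ = ∑ᶠ verifyᶠ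

candidateᶠ : Functional 1 2
candidateᶠ = recᶠ (litᶠ 0)
  (ifZeroᶠ (call₃ refutationsᶠ (sucᶠ (varᶠ 0F)) (varᶠ 1F) (varᶠ 2F)) (varᶠ 1F) (sucᶠ (varᶠ 1F)))

movementᶠ : Functional 1 2
movementᶠ = call₃ refutationsᶠ (sucᶠ (varᶠ 0F)) candidateᶠ (varᶠ 1F)

module _ (x : Instance 0 2) (u : ℕ) where
  verify : ℕ → ℕ → ℕ
  verify v e = eval verifyᶠ (code x ∷ []) (e ∷ v ∷ u ∷ [])

  open Guessing verify public

-- The tests at c and d, both at most c + d, single out `v`. If a or b is not in the poset, there is
-- no uniqueness, but the matrix holds vacuously and no candidate is ever left.
lattice-settles : ∀ x → PosetInstance x → ∀ u v → (∀ e → Verified x u v e) →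
                  ∀ m → fst v + snd v + v ≤ m → movement x u m ≡ 0
lattice-settles x@(inst [] (χ ∷ ρ ∷ [])) P u v ver with χ (fst u) ≟ 1 | χ (snd u) ≟ 1
... | yes χa | yes χb = settles x u v (fst v + snd v)
  (λ e → ⇒verifyᶠ≡0 x u v e (ver e))
  (λ v′ eq → let ver′ = λ e e≤ → verifyᶠ≡0⇒ x u v′ e (eq e e≤) in
             meetJoin-unique P u v v′ χa χb ver (ver′ (fst v) (m≤m+n _ _)) (ver′ (snd v) (m≤n+m _ _)))
... | no a∉  | _      = λ m _ → ⇒∑<≡0 (suc m) λ e _ →
  ⇒verifyᶠ≡0 x u _ e (λ (χa , _) → contradiction χa a∉)
... | yes _  | no b∉  = λ m _ → ⇒∑<≡0 (suc m) λ e _ →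
  ⇒verifyᶠ≡0 x u _ e (λ (_ , χb) → contradiction χb b∉)

Lattice≤eventuallyZero : Lattice ≤dm unrestricted eventuallyZero
Lattice≤eventuallyZero =
  programOf η ,
  reduction {A = Lattice} {B = unrestricted eventuallyZero} η target settling limit
    target-isInstance (λ _ _ _ → refl)
    (λ x (_ , P) α w u m t≤m → trans (unrowᶠ-pair movementᶠ _ u m)
       (lattice-settles x P u (α (pair u 0)) (λ e → proj₂ (w u e)) m t≤m))
    (λ x _ α w u e → verifyᶠ≡0⇒ x u (candidate x u (α (pair u 0))) e
       (settled⇒unrefuted x u (α (pair u 0))
         (λ m t≤m → trans (sym (unrowᶠ-pair movementᶠ _ u m)) (proj₂ (w u m t≤m))) e)) ,
  reduction {A = dual Lattice} {B = dual (unrestricted eventuallyZero)} η target movements refuter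
    target-isInstance (λ _ _ _ → refl)
    (λ x _ α w m →
       -- The witness names an e that refutes the present candidate, which bounds the search for the
       -- next movement.
       let u = α 0 ; v = candidate x u m ; e = α (suc (pair v 0))
           m′ = search (movement x u) m (suc e) in
       start≤search (movement x u) m (suc e) , λ eq →
       moves-when-refuted x u m e
         (λ eq → proj₂ (w v) (verifyᶠ≡0⇒ x u v e eq))
         (trans (sym (unrowᶠ-pair movementᶠ _ u m′)) eq))
    (λ x _ α w v true → let u = α 0 ; g = λ m → α (suc (pair m 0)) in
       moment-refutes x u g (λ m → proj₁ (w m))
         (λ m eq → proj₂ (proj₂ (w m)) (trans (unrowᶠ-pair movementᶠ _ u (g m)) eq)) v
         (⇒verifyᶠ≡0 x u v _ true))
  where
  η = unrowᶠ movementᶠ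

  target : Instance 0 2 → Instance 0 1
  target x = inst [] (function η (code x ∷ []) ∷ [])

  target-isInstance : ∀ x → ComputableInstance x × PosetInstance x → ComputableInstance (target x) × _
  target-isInstance x (comp , _) = functionOfCode-computable η x comp ∷ [] , _

  settling : Strategy 2 (`∀ ∷ `∀∞ ∷ []) 0
  settling = `∀ (`∀∞ (fstᶠ v +ᶠ sndᶠ v +ᶠ v) done)
    where v = oracleᶠ 0F (pairᶠ (varᶠ 0F) (litᶠ 0))

  limit : Strategy 2 (`∀ ∷ `∃ ∷ `∀ ∷ []) 0
  limit = `∀ (`∃ (call₂ (shiftᶠ candidateᶠ) (oracleᶠ 0F (pairᶠ (varᶠ 0F) (litᶠ 0))) (varᶠ 0F)) (`∀ done))

  movements : Strategy 2 (`∃ ∷ `∃∞ ∷ []) 0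
  movements = `∃ (oracleᶠ 0F (litᶠ 0)) (`∃∞
    (call₃ (searchᶠ (shiftᶠ movementᶠ))
      (sucᶠ (oracleᶠ 0F (sucᶠ (pairᶠ (shiftᶠ candidateᶠ) (litᶠ 0))))) (varᶠ 0F) (varᶠ 1F)) done)

  refuter : Strategy 2 (`∃ ∷ `∀ ∷ `∃ ∷ []) 0
  refuter = `∃ (oracleᶠ 0F (litᶠ 0)) (`∀ (`∃
    (callᶠ (searchᶠ (shiftᶠ verifyᶠ))
      (sucᶠ (call₁ momentᶠ (varᶠ 0F)) ∷ litᶠ 0 ∷ varᶠ 0F ∷ varᶠ 1F ∷ [])) done))
    where
    enumerator : Functional 2 n → Functional 2 n
    enumerator m = oracleᶠ 0F (sucᶠ (pairᶠ m (litᶠ 0)))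

    momentᶠ : Functional 2 1
    momentᶠ = recᶠ {n = 0} (enumerator (litᶠ 0)) (enumerator (sucᶠ (varᶠ 1F)))

-- The order on all points.

-- The points (n , i) are ordered lexicographically, where the second coordinates
-- form the chain 2 ⊴ 3 ⊴ 4 ⊴ … below the two incomparable elements 0 and 1.

_⊴_ : ℕ → ℕ → Set
i ⊴ j = i ≡ j ⊎ (2 ≤ i × (j ≤ 1 ⊎ i ≤ j))

⊴-trans : ∀ {i j k} → i ⊴ j → j ⊴ k → i ⊴ k
⊴-trans (inj₁ refl) j⊴k = j⊴k
⊴-trans i⊴j (inj₁ refl) = i⊴j
⊴-trans (inj₂ (_ , inj₁ j≤1)) (inj₂ (2≤j , _))             = contradiction j≤1 (<⇒≱ 2≤j)
⊴-trans (inj₂ (2≤i , inj₂ _)) (inj₂ (_ , inj₁ k≤1))        = inj₂ (2≤i , inj₁ k≤1)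
⊴-trans (inj₂ (2≤i , inj₂ i≤j)) (inj₂ (_ , inj₂ j≤k))      = inj₂ (2≤i , inj₂ (≤-trans i≤j j≤k))

⊴-antisym : ∀ {i j} → i ⊴ j → j ⊴ i → i ≡ j
⊴-antisym (inj₁ i≡j) _ = i≡j
⊴-antisym _ (inj₁ j≡i) = sym j≡i
⊴-antisym (inj₂ (_ , inj₁ j≤1)) (inj₂ (2≤j , _))        = contradiction j≤1 (<⇒≱ 2≤j)
⊴-antisym (inj₂ (2≤i , _)) (inj₂ (_ , inj₁ i≤1))        = contradiction i≤1 (<⇒≱ 2≤i)
⊴-antisym (inj₂ (_ , inj₂ i≤j)) (inj₂ (_ , inj₂ j≤i))   = ≤-antisym i≤j j≤i

⊴-connex : ∀ i j → i ⊴ j ⊎ j ⊴ i ⊎ (i ≤ 1 × j ≤ 1 × i ≢ j)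
⊴-connex i j with i ≤? 1 | j ≤? 1
... | no i≰1  | yes j≤1 = inj₁ (inj₂ (≰⇒> i≰1 , inj₁ j≤1))
... | yes i≤1 | no j≰1  = inj₂ (inj₁ (inj₂ (≰⇒> j≰1 , inj₁ i≤1)))
... | no i≰1  | no j≰1  with ≤-total i j
...   | inj₁ i≤j = inj₁ (inj₂ (≰⇒> i≰1 , inj₂ i≤j))
...   | inj₂ j≤i = inj₂ (inj₁ (inj₂ (≰⇒> j≰1 , inj₂ j≤i)))
⊴-connex i j | yes i≤1 | yes j≤1 with i ≟ j
...   | yes i≡j = inj₁ (inj₁ i≡j)
...   | no  i≢j = inj₂ (inj₂ (i≤1 , j≤1 , i≢j))

Point : Set
Point = ℕ × ℕ

_≼_ : Point → Point → Set
(n , i) ≼ (m , j) = n < m ⊎ (n ≡ m × i ⊴ j)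

≼-refl : ∀ {a} → a ≼ a
≼-refl = inj₂ (refl , inj₁ refl)

≼-trans : ∀ {a b c} → a ≼ b → b ≼ c → a ≼ c
≼-trans (inj₁ n<m) (inj₁ m<l)                   = inj₁ (<-trans n<m m<l)
≼-trans (inj₁ n<m) (inj₂ (refl , _))            = inj₁ n<m
≼-trans (inj₂ (refl , _)) (inj₁ m<l)            = inj₁ m<l
≼-trans (inj₂ (refl , i⊴j)) (inj₂ (refl , j⊴k)) = inj₂ (refl , ⊴-trans i⊴j j⊴k)

≼-antisym : ∀ {a b} → a ≼ b → b ≼ a → a ≡ b
≼-antisym (inj₁ n<m) (inj₁ m<n)                   = contradiction m<n (<-asym n<m)
≼-antisym (inj₁ n<m) (inj₂ (refl , _))            = contradiction n<m (<-irrefl refl)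
≼-antisym (inj₂ (refl , _)) (inj₁ m<n)            = contradiction m<n (<-irrefl refl)
≼-antisym (inj₂ (refl , i⊴j)) (inj₂ (_ , j⊴i))    = cong (_ ,_) (⊴-antisym i⊴j j⊴i)

Twins : Point → Point → Set
Twins (n , i) (m , j) = n ≡ m × i ≤ 1 × j ≤ 1 × i ≢ j

≼-connex : ∀ a b → a ≼ b ⊎ b ≼ a ⊎ Twins a b
≼-connex (n , i) (m , j) with <-cmp n m
... | tri< n<m _ _ = inj₁ (inj₁ n<m)
... | tri> _ _ m<n = inj₂ (inj₁ (inj₁ m<n))
... | tri≈ _ refl _ with ⊴-connex i j
...   | inj₁ i⊴j          = inj₁ (inj₂ (refl , i⊴j))
...   | inj₂ (inj₁ j⊴i)   = inj₂ (inj₁ (inj₂ (refl , j⊴i)))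
...   | inj₂ (inj₂ twins) = inj₂ (inj₂ (refl , twins))

-- Below a twin in its own block there are only the twin itself and the chain, and no point equals
-- both twins.
twins-lower : ∀ {n i j m l} → i ≤ 1 → j ≤ 1 → i ≢ j → (m , l) ≼ (n , i) → (m , l) ≼ (n , j) →
              m < n ⊎ (m ≡ n × 2 ≤ l)
twins-lower _ _ _ (inj₁ m<n) _ = inj₁ m<n
twins-lower _ _ _ _ (inj₁ m<n) = inj₁ m<n
twins-lower _ _ _ (inj₂ (m≡n , inj₂ (2≤l , _))) _ = inj₂ (m≡n , 2≤l)
twins-lower _ _ _ _ (inj₂ (m≡n , inj₂ (2≤l , _))) = inj₂ (m≡n , 2≤l)
twins-lower _ _ i≢j (inj₂ (_ , inj₁ refl)) (inj₂ (_ , inj₁ refl)) = contradiction refl i≢j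

twins-upper : ∀ {n i j m l} → i ≤ 1 → j ≤ 1 → i ≢ j → (n , i) ≼ (m , l) → (n , j) ≼ (m , l) →
              n < m
twins-upper _ _ _ (inj₁ n<m) _ = n<m
twins-upper _ _ _ _ (inj₁ n<m) = n<m
twins-upper i≤1 _ _ (inj₂ (_ , inj₂ (2≤i , _))) _ = contradiction i≤1 (<⇒≱ 2≤i)
twins-upper _ j≤1 _ _ (inj₂ (_ , inj₂ (2≤j , _))) = contradiction j≤1 (<⇒≱ 2≤j)
twins-upper _ _ i≢j (inj₂ (_ , inj₁ refl)) (inj₂ (_ , inj₁ refl)) = contradiction refl i≢j

-- The chain of each block starts with 2, and the twins lie above it. This makes the least element
-- of the next block the join of the twins.
bottom-≼ : ∀ {n m l} → n < m → (suc n , 2) ≼ (m , l)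
bottom-≼ {n} {m} {l} n<m with m≤n⇒m<n∨m≡n n<m
... | inj₁ 1+n<m = inj₁ 1+n<m
... | inj₂ 1+n≡m with l ≤? 1
...   | yes l≤1 = inj₂ (1+n≡m , inj₂ (≤-refl , inj₁ l≤1))
...   | no  l≰1 = inj₂ (1+n≡m , inj₂ (≤-refl , inj₂ (≰⇒> l≰1)))

-- Meets and joins in the poset of f.

-- The poset attached to f consists of the points (n , i) with i ≤ 2 or
-- f ⟨n,i⟩ ≢ 0. Only (n , 0) and (n , 1) are incomparable: their join is (1+n , 2),
-- and they have a meet just if the chain of the (n , i) with i ≥ 2 is finite.

module _ (f : Baire) where
  Present : Point → Set
  Present (n , i) = i ≤ 2 ⊎ f (pair n i) ≢ 0

  -- The counterpart of `Verified` on points, for present a and b. It keeps a single e, because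
  -- witnesses for the dual refute a candidate at one e only.
  record MeetJoinAt (a b c d e : Point) : Set where
    constructor meetJoinAt
    field
      present  : Present c × Present d
      bounds   : Present e → c ≼ a × c ≼ b × a ≼ d × b ≼ d
      greatest : Present e → e ≼ a × e ≼ b → e ≼ c
      least    : Present e → a ≼ e × b ≼ e → d ≼ e

  -- The end of the chain of block n as far as seen below the given stage. The expression
  -- `2 + (t ∸ 2)` is the maximum of 2 and t: nonzero values at arguments up to 2 add nothing to the
  -- chain.
  last : ℕ → ℕ → ℕ
  last n = natRec 2 (λ t i → ifZero (f (pair n t)) i (2 + (t ∸ 2)))

  2≤last : ∀ n t → 2 ≤ last n t
  2≤last n zero = ≤-refl
  2≤last n (suc t) with f (pair n t)
  ... | zero  = 2≤last n t
  ... | suc _ = s≤s (s≤s z≤n)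

  last-present : ∀ n t → Present (n , last n t)
  last-present n zero = inj₁ ≤-refl
  last-present n (suc t) with f (pair n t) in eq
  ... | zero  = last-present n t
  ... | suc _ with ≤-total t 2
  ...   | inj₁ t≤2 = inj₁ (≤-reflexive (cong (2 +_) (m≤n⇒m∸n≡0 t≤2)))
  ...   | inj₂ 2≤t = inj₂ λ ≡0 →
    1+n≢0 (trans (sym eq) (trans (cong (λ i → f (pair n i)) (sym (m+[n∸m]≡n 2≤t))) ≡0))

  ≤last : ∀ n t i → i < t → f (pair n i) ≢ 0 → i ≤ last n t
  ≤last n (suc t) i (s≤s i≤t) ≢0 with f (pair n t) in eq
  ... | suc _ = ≤-trans i≤t (m≤n+m∸n t 2)
  ... | zero  = ≤last n t i (≤∧≢⇒< i≤t λ { refl → ≢0 eq }) ≢0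

  present≤last : ∀ n t i → 2 ≤ i → Present (n , i) → (f (pair n i) ≢ 0 → i < t) → i ≤ last n t
  present≤last n t i 2≤i (inj₁ i≤2) _    = ≤-trans i≤2 (2≤last n t)
  present≤last n t i 2≤i (inj₂ ≢0)  i<t = ≤last n t i (i<t ≢0) ≢0

  comparable-meetJoin : ∀ {a b} e → a ≼ b → Present a → Present b → MeetJoinAt a b a b e
  comparable-meetJoin e a≼b pa pb = meetJoinAt (pa , pb)
    (λ _ → ≼-refl , a≼b , a≼b , ≼-refl) (λ _ → proj₁) (λ _ → proj₂)

  swap-meetJoin : ∀ {a b c d e} → MeetJoinAt a b c d e → MeetJoinAt b a c d e
  swap-meetJoin (meetJoinAt p bs m j) = meetJoinAt p
    (λ pe → let (ca , cb , ad , bd) = bs pe in cb , ca , bd , ad)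
    (λ pe (eb , ea) → m pe (ea , eb)) (λ pe (be , ae) → j pe (ae , be))

  -- The bound `t` is required for the tested point `e` only. This covers both a function that
  -- vanishes from `t` on and a single alleged refutation.
  twins-meetJoin : ∀ {a b} t e → Twins a b →
    (proj₁ e ≡ proj₁ a → f (pair (proj₁ a) (proj₂ e)) ≢ 0 → proj₂ e < t) →
    MeetJoinAt a b (proj₁ a , last (proj₁ a) t) (suc (proj₁ a) , 2) e
  twins-meetJoin {n , i} t (m , l) (refl , i≤1 , j≤1 , i≢j) l<t = meetJoinAt
    (last-present n t , inj₁ ≤-refl)
    (λ _ → inj₂ (refl , inj₂ (2≤last n t , inj₁ i≤1)) , inj₂ (refl , inj₂ (2≤last n t , inj₁ j≤1)) ,
           inj₁ ≤-refl , inj₁ ≤-refl)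
    (λ { pe (e≼a , e≼b) → lower pe (twins-lower i≤1 j≤1 i≢j e≼a e≼b) })
    (λ { _ (a≼e , b≼e) → bottom-≼ (twins-upper i≤1 j≤1 i≢j a≼e b≼e) })
    where
    lower : Present (m , l) → m < n ⊎ (m ≡ n × 2 ≤ l) → (m , l) ≼ (n , last n t)
    lower pe (inj₁ m<n)          = inj₁ m<n
    lower pe (inj₂ (refl , 2≤l)) = inj₂ (refl , inj₂ (2≤l , inj₂ (present≤last n t l 2≤l pe (l<t refl))))

  -- The point `(n , i)` is below both twins and hence below c. Being itself a lower bound of the
  -- twins, c then lies in the chain of the same block.
  twins-meet-bound : ∀ n i {c d} → 2 ≤ i → f (pair n i) ≢ 0 →
    MeetJoinAt (n , 0) (n , 1) c d (n , i) → i ≤ proj₂ c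
  twins-meet-bound n i {m , l} 2≤i ≢0 (meetJoinAt _ bounds meet _)
    with (c≼a , c≼b , _) ← bounds (inj₂ ≢0)
    with meet (inj₂ ≢0) (inj₂ (refl , inj₂ (2≤i , inj₁ z≤n)) , inj₂ (refl , inj₂ (2≤i , inj₁ ≤-refl)))
       | twins-lower z≤n ≤-refl (λ ()) c≼a c≼b
  ... | inj₁ n<m | inj₁ m<n = contradiction m<n (<-asym n<m)
  ... | inj₁ n<m | inj₂ (refl , _) = contradiction n<m (<-irrefl refl)
  ... | inj₂ (refl , _) | inj₁ m<n = contradiction m<n (<-irrefl refl)
  ... | inj₂ (_ , inj₁ refl) | inj₂ _ = ≤-refl
  ... | inj₂ (_ , inj₂ (_ , inj₂ i≤l)) | inj₂ _ = i≤l
  ... | inj₂ (_ , inj₂ (_ , inj₁ l≤1)) | inj₂ (_ , 2≤l) = contradiction l≤1 (<⇒≱ 2≤l)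

-- The coded poset and the translation of its meets and joins.

presentᵇ : Term p 1 → Bounded p 1
presentᵇ a = sndᵗ a ≤ᵇ sucᵗ (sucᵗ zeroᵗ) ∨ᵇ ¬ᵇ (app 0F (pairᵗ (fstᵗ a) (sndᵗ a)) ≐ zeroᵗ)

-- Like `presentᵇ`, it is arranged so that its meaning unfolds to the relation on decoded points.
_≼ᵇ_ : Term p 1 → Term p 1 → Bounded p 1
a ≼ᵇ b = sucᵗ (fstᵗ a) ≤ᵇ fstᵗ b ∨ᵇ (fstᵗ a ≐ fstᵗ b ∧ᵇ
  (sndᵗ a ≐ sndᵗ b ∨ᵇ
   (sucᵗ (sucᵗ zeroᵗ) ≤ᵇ sndᵗ a ∧ᵇ (sndᵗ b ≤ᵇ sucᵗ zeroᵗ ∨ᵇ sndᵗ a ≤ᵇ sndᵗ b))))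

relationᵇ : Bounded 1 1
relationᵇ = presentᵇ (fstᵗ c) ∧ᵇ presentᵇ (sndᵗ c) ∧ᵇ (fstᵗ c ≼ᵇ sndᵗ c)
  where c = var 0F

abstract
  characteristicᶠ : Bounded 1 1 → Functional 1 1
  characteristicᶠ θ = litᶠ 1 ∸ᶠ testᶠ 1 θ

  characteristicᶠ≤1 : ∀ θ αs j → function (characteristicᶠ θ) αs j ≤ 1
  characteristicᶠ≤1 θ αs j = m∸n≤m 1 (eval (testᶠ 1 θ) αs (j ∷ []))

  characteristicᶠ≡1⇒ : ∀ θ x j → function (characteristicᶠ θ) (code x ∷ []) j ≡ 1 → ⟦ θ ⟧ᵇ (j ◂ x)
  characteristicᶠ≡1⇒ θ x j eq = testᶠ≡0⇒ x (j ∷ []) θ (1∸m≡1⇒m≡0 eq)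
    where
    1∸m≡1⇒m≡0 : ∀ {m} → 1 ∸ m ≡ 1 → m ≡ 0
    1∸m≡1⇒m≡0 {zero}  _  = refl
    1∸m≡1⇒m≡0 {suc m} eq = contradiction (trans (sym eq) (0∸n≡0 m)) 1+n≢0

  ⇒characteristicᶠ≡1 : ∀ θ x j → ⟦ θ ⟧ᵇ (j ◂ x) → function (characteristicᶠ θ) (code x ∷ []) j ≡ 1
  ⇒characteristicᶠ≡1 θ x j true = cong (1 ∸_) (⇒testᶠ≡0 x (j ∷ []) θ true)

χᶠ ρᶠ : Functional 1 1
χᶠ = characteristicᶠ (presentᵇ (var 0F))
ρᶠ = characteristicᶠ relationᵇ

posetOf : Instance 0 1 → Instance 0 2
posetOf x = inst [] (function χᶠ (code x ∷ []) ∷ function ρᶠ (code x ∷ []) ∷ [])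

module _ (f : Baire) where
  private
    x = inst [] (f ∷ [])
    χ = function χᶠ (f ∷ [])
    ρ = function ρᶠ (f ∷ [])

  χ⇒ : ∀ a → χ a ≡ 1 → Present f (unpair a)
  χ⇒ = characteristicᶠ≡1⇒ (presentᵇ (var 0F)) x

  ⇒χ : ∀ a → Present f (unpair a) → χ a ≡ 1
  ⇒χ = ⇒characteristicᶠ≡1 (presentᵇ (var 0F)) x

  Related : ℕ × ℕ → Set
  Related (a , b) = Present f (unpair a) × Present f (unpair b) × unpair a ≼ unpair b

  ρ⇒ : ∀ a b → ρ (pair a b) ≡ 1 → Related (a , b)
  ρ⇒ a b eq = subst Related (unpair-pair a b) (characteristicᶠ≡1⇒ relationᵇ x (pair a b) eq)

  ⇒ρ : ∀ a b → Related (a , b) → ρ (pair a b) ≡ 1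
  ⇒ρ a b rel =
    ⇒characteristicᶠ≡1 relationᵇ x (pair a b) (subst Related (sym (unpair-pair a b)) rel)

  ρ⇒≼ : ∀ a b → ρ (pair a b) ≡ 1 → unpair a ≼ unpair b
  ρ⇒≼ a b eq = proj₂ (proj₂ (ρ⇒ a b eq))

  posetOf-isPoset : IsPosetCode χ ρ
  posetOf-isPoset = record
    { isRelationCode = record
      { χ-01 = characteristicᶠ≤1 (presentᵇ (var 0F)) (f ∷ [])
      ; ρ-01 = characteristicᶠ≤1 relationᵇ (f ∷ [])
      ; R⊆X² = λ a b eq → let (pa , pb , _) = ρ⇒ a b eq in ⇒χ a pa , ⇒χ b pb
      }
    ; isPartialOrder = record
      { isPreorder = record
        { isEquivalence = record { refl = refl ; sym = sym ; trans = trans }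
        ; reflexive = λ { {a , pa} refl → ⇒ρ a a (χ⇒ a pa , χ⇒ a pa , ≼-refl) }
        ; trans = λ { {a , pa} {b , _} {c , pc} a⊑b b⊑c →
            ⇒ρ a c (χ⇒ a pa , χ⇒ c pc , ≼-trans (ρ⇒≼ a b a⊑b) (ρ⇒≼ b c b⊑c)) }
        }
      ; antisym = λ { {a , _} {b , _} a⊑b b⊑a →
          trans (sym (pair-unpair a))
            (trans (cong (λ (n , i) → pair n i) (≼-antisym (ρ⇒≼ a b a⊑b) (ρ⇒≼ b a b⊑a)))
                   (pair-unpair b)) }
      }
    }

  Decodes : ℕ → Point → Point → Set
  Decodes u a b = unpair (fst u) ≡ a × unpair (snd u) ≡ b

  verified⇒ : ∀ u v e {a b c d e′} → Decodes u a b → Decodes v c d → unpair e ≡ e′ →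
    Present f a → Present f b → Verified (posetOf x) u v e → MeetJoinAt f a b c d e′
  verified⇒ u v e (refl , refl) (refl , refl) refl pa pb ver =
    let (c∈ , d∈) , at = ver (⇒χ (fst u) pa , ⇒χ (snd u) pb)
        pc = χ⇒ (fst v) c∈
        pd = χ⇒ (snd v) d∈
    in meetJoinAt (pc , pd)
      (λ pe → let (ca , cb , ad , bd) , _ = at (⇒χ e pe) in
        ρ⇒≼ (fst v) (fst u) ca , ρ⇒≼ (fst v) (snd u) cb ,
        ρ⇒≼ (fst u) (snd v) ad , ρ⇒≼ (snd u) (snd v) bd)
      (λ pe (ea , eb) → let _ , meet , _ = at (⇒χ e pe) in
        ρ⇒≼ e (fst v) (meet (⇒ρ e (fst u) (pe , pa , ea) , ⇒ρ e (snd u) (pe , pb , eb))))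
      (λ pe (ae , be) → let _ , _ , join = at (⇒χ e pe) in
        ρ⇒≼ (snd v) e (join (⇒ρ (fst u) e (pa , pe , ae) , ⇒ρ (snd u) e (pb , pe , be))))

  ⇒verified : ∀ u v e {a b c d} → Decodes u a b → Decodes v c d →
    (Present f a → Present f b → MeetJoinAt f a b c d (unpair e)) → Verified (posetOf x) u v e
  ⇒verified u v e (refl , refl) (refl , refl) mj (a∈ , b∈) =
    let pa = χ⇒ (fst u) a∈
        pb = χ⇒ (snd u) b∈
        meetJoinAt (pc , pd) bounds meet join = mj pa pb
    in (⇒χ (fst v) pc , ⇒χ (snd v) pd) , λ e∈ →
      let pe = χ⇒ e e∈
          (ca , cb , ad , bd) = bounds pe
      in (⇒ρ (fst v) (fst u) (pc , pa , ca) , ⇒ρ (fst v) (snd u) (pc , pb , cb) ,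
          ⇒ρ (fst u) (snd v) (pa , pd , ad) , ⇒ρ (snd u) (snd v) (pb , pd , bd)) ,
         (λ (ea , eb) → ⇒ρ e (fst v) (pe , pc , meet pe (ρ⇒≼ e (fst u) ea , ρ⇒≼ e (snd u) eb))) ,
         (λ (ae , be) → ⇒ρ (snd v) e (pd , pe , join pe (ρ⇒≼ (fst u) e ae , ρ⇒≼ (snd u) e be)))

  decodes-pair : ∀ a b → Decodes (pair a b) (unpair a) (unpair b)
  decodes-pair a b rewrite unpair-pair a b = refl , refl

  decodes-points : ∀ n i m j → Decodes (pair (pair n i) (pair m j)) (n , i) (m , j)
  decodes-points n i m j
    rewrite unpair-pair (pair n i) (pair m j) | unpair-pair n i | unpair-pair m j = refl , refl

  twinsMeetJoin : ℕ → ℕ → ℕ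
  twinsMeetJoin n t = pair (pair n (last f n t)) (pair (suc n) 2)

  -- Comparable elements are their own meet and join, in the right order. Elements that fail both
  -- tests are twins, whose block is read off the first of them.
  meetJoin : ℕ → ℕ → ℕ → ℕ
  meetJoin a b t = ifZero (ρ (pair a b))
    (ifZero (ρ (pair b a)) (twinsMeetJoin (fst a) t) (pair b a)) (pair a b)

  twinsMeetJoin-verified : ∀ u t e → Twins (unpair (fst u)) (unpair (snd u)) →
    (fst e ≡ fst (fst u) → f (pair (fst (fst u)) (snd e)) ≢ 0 → snd e < t) →
    Verified (posetOf x) u (twinsMeetJoin (fst (fst u)) t) e
  twinsMeetJoin-verified u t e twins bound =
    ⇒verified u (twinsMeetJoin (fst (fst u)) t) e (refl , refl) (decodes-points _ _ _ _)
      (λ _ _ → twins-meetJoin f t (unpair e) twins bound)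

  comparable-verified : ∀ u e → unpair (fst u) ≼ unpair (snd u) →
    Verified (posetOf x) u (pair (fst u) (snd u)) e
  comparable-verified u e a≼b = ⇒verified u (pair (fst u) (snd u)) e (refl , refl)
    (decodes-pair (fst u) (snd u)) (comparable-meetJoin f (unpair e) a≼b)

  comparableʳ-verified : ∀ u e → unpair (snd u) ≼ unpair (fst u) →
    Verified (posetOf x) u (pair (snd u) (fst u)) e
  comparableʳ-verified u e b≼a = ⇒verified u (pair (snd u) (fst u)) e (refl , refl)
    (decodes-pair (snd u) (fst u))
    (λ pa pb → swap-meetJoin f (comparable-meetJoin f (unpair e) b≼a pb pa))

  ρ≡1 : ∀ {c v} → ρ c ≡ suc v → ρ c ≡ 1
  ρ≡1 {c} eq = ≤-antisym (characteristicᶠ≤1 relationᵇ (f ∷ []) c)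
                         (≤-trans (s≤s z≤n) (≤-reflexive (sym eq)))

  meetJoin-verified : ∀ t u e →
    (∀ m → t ≤ m → f (pair (fst (fst u)) m) ≡ 0) →
    Verified (posetOf x) u (meetJoin (fst u) (snd u) t) e
  meetJoin-verified t u e vanishes (a∈ , b∈)
    with ρ (pair (fst u) (snd u)) in a⊑b | ρ (pair (snd u) (fst u)) in b⊑a
  ... | suc _ | _     = comparable-verified u e (ρ⇒≼ (fst u) (snd u) (ρ≡1 a⊑b)) (a∈ , b∈)
  ... | zero  | suc _ = comparableʳ-verified u e (ρ⇒≼ (snd u) (fst u) (ρ≡1 b⊑a)) (a∈ , b∈)
  ... | zero  | zero  with ≼-connex (unpair (fst u)) (unpair (snd u))
  -- The premise of the matrix says that both numbers are elements, so comparable points would have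
  -- been detected by `ρ`.
  ...   | inj₁ a≼b = contradiction
    (trans (sym a⊑b) (⇒ρ (fst u) (snd u) (χ⇒ (fst u) a∈ , χ⇒ (snd u) b∈ , a≼b))) λ ()
  ...   | inj₂ (inj₁ b≼a) = contradiction
    (trans (sym b⊑a) (⇒ρ (snd u) (fst u) (χ⇒ (snd u) b∈ , χ⇒ (fst u) a∈ , b≼a))) λ ()
  ...   | inj₂ (inj₂ twins) = twinsMeetJoin-verified u t e twins
    (λ _ ≢0 → ≰⇒> (λ t≤ → ≢0 (vanishes (snd e) t≤))) (a∈ , b∈)

  twins : ℕ → ℕ
  twins n = pair (pair n 0) (pair n 1)

  verified-bound : ∀ n v i → 2 ≤ i → f (pair n i) ≢ 0 →
    Verified (posetOf x) (twins n) v (pair n i) → i ≤ snd (fst v)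
  verified-bound n v i 2≤i ≢0 ver = twins-meet-bound f n i 2≤i ≢0
    (verified⇒ (twins n) v (pair n i) (decodes-points n 0 n 1) (refl , refl) (unpair-pair n i)
      (inj₁ z≤n) (inj₁ (s≤s z≤n)) ver)

  -- A comparable pair has a meet and a join that nothing refutes, so `u` consists of twins. Their
  -- candidate computed from stage `m` can only be refuted by a later point of the chain, where f
  -- does not vanish.
  refuted-nonvanishing : ∀ u (E : ℕ → ℕ) → (∀ v → ¬ Verified (posetOf x) u v (E v)) →
    ∀ m → let n = fst (fst u) ; k = snd (E (twinsMeetJoin n m)) in m ≤ k × f (pair n k) ≢ 0
  refuted-nonvanishing u E refutes m with ≼-connex (unpair (fst u)) (unpair (snd u))
  ... | inj₁ a≼b        = contradiction (comparable-verified u _ a≼b) (refutes (pair (fst u) (snd u)))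
  ... | inj₂ (inj₁ b≼a) = contradiction (comparableʳ-verified u _ b≼a) (refutes (pair (snd u) (fst u)))
  ... | inj₂ (inj₂ tw) 
    with m ≤? snd (E (twinsMeetJoin (fst (fst u)) m))
       | f (pair (fst (fst u)) (snd (E (twinsMeetJoin (fst (fst u)) m)))) ≟ 0
  ...   | yes m≤k | no ≢0 = m≤k , ≢0
  ...   | _       | yes ≡0 =
    contradiction (twinsMeetJoin-verified u m _ tw (λ _ ≢0 → contradiction ≡0 ≢0)) (refutes _)
  ...   | no m≰k  | _ =
    contradiction (twinsMeetJoin-verified u m _ tw (λ _ _ → ≰⇒> m≰k)) (refutes _)

-- Reduction of `eventuallyZero` to `Lattice`.

lastᶠ : Functional 1 2
lastᶠ = recᶠ (litᶠ 2)
  (ifZeroᶠ (oracleᶠ 0F (pairᶠ (varᶠ 2F) (varᶠ 0F))) (varᶠ 1F) (litᶠ 2 +ᶠ (varᶠ 0F ∸ᶠ litᶠ 2)))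

twinsMeetJoinᶠ : Functional 1 2
twinsMeetJoinᶠ = pairᶠ (pairᶠ (varᶠ 0F) (call₂ lastᶠ (varᶠ 1F) (varᶠ 0F)))
                       (pairᶠ (sucᶠ (varᶠ 0F)) (litᶠ 2))

meetJoinᶠ : Functional 1 3
meetJoinᶠ = ifZeroᶠ (call₁ ρᶠ (pairᶠ (varᶠ 0F) (varᶠ 1F)))
  (ifZeroᶠ (call₁ ρᶠ (pairᶠ (varᶠ 1F) (varᶠ 0F)))
    (call₂ twinsMeetJoinᶠ (fstᶠ (varᶠ 0F)) (varᶠ 2F)) (pairᶠ (varᶠ 1F) (varᶠ 0F)))
  (pairᶠ (varᶠ 0F) (varᶠ 1F))

eventuallyZero≤Lattice : unrestricted eventuallyZero ≤dm Lattice
eventuallyZero≤Lattice =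
  programOf η ,
  reduction {A = unrestricted eventuallyZero} {B = Lattice} η posetOf meetsJoins bound
    posetOf-isInstance (λ _ _ _ → refl)
    (λ { (inst [] (f ∷ [])) _ α w u e →
      meetJoin-verified f (α (pair (fst (fst u)) 0)) u e (λ m t≤m → proj₂ (w (fst (fst u)) m t≤m)) })
    (λ { (inst [] (f ∷ [])) _ α w n m t≤m → vanishes f n m (α (pair (twins f n) 0)) t≤m
      (proj₂ (w (twins f n) (pair n m))) }) ,
  reduction {A = dual (unrestricted eventuallyZero)} {B = dual Lattice} η posetOf unboundedTwins enumeration
    posetOf-isInstance (λ _ _ _ → refl)
    (λ { (inst [] (f ∷ [])) _ α w v ver →
      -- The value asked for exceeds the second coordinate of the proposed meet, and the summand 2
      -- places it in the chain.
      let m = 2 + snd (fst v) ; m≤k , _ , ≢0 = w m ; k = α (suc (pair m 0)) in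
      contradiction
        (verified-bound f (α 0) v k (≤-trans (m≤m+n 2 (snd (fst v))) m≤k) ≢0 ver)
        (<⇒≱ (≤-trans (n≤1+n _) m≤k)) })
    (λ { (inst [] (f ∷ [])) _ α w m →
      refuted-nonvanishing f (α 0) (λ v → α (suc (pair v 0))) (λ v → proj₂ (w v)) m })
  where
  η = joinᶠ χᶠ ρᶠ

  -- A nonzero value of f would be a point of the chain that lies beyond the meet.
  vanishes : ∀ f n m v → 2 + snd (fst v) ≤ m →
    Verified (posetOf (inst [] (f ∷ []))) (twins f n) v (pair n m) → f (pair n m) ≡ 0
  vanishes f n m v t≤m ver with f (pair n m) ≟ 0
  ... | yes ≡0 = ≡0
  ... | no  ≢0 = contradiction
    (verified-bound f n v m (≤-trans (m≤m+n 2 (snd (fst v))) t≤m) ≢0 ver)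
    (<⇒≱ (≤-trans (n≤1+n _) t≤m))

  posetOf-isInstance : ∀ x → ComputableInstance x × _ → ComputableInstance (posetOf x) × PosetInstance (posetOf x)
  posetOf-isInstance x@(inst [] (f ∷ [])) (comp , _) =
    functionOfCode-computable χᶠ x comp ∷ functionOfCode-computable ρᶠ x comp ∷ [] , posetOf-isPoset f

  meetsJoins : Strategy 2 (`∀ ∷ `∃ ∷ `∀ ∷ []) 0
  meetsJoins = `∀ (`∃ (call₃ (shiftᶠ meetJoinᶠ) (fstᶠ (varᶠ 0F)) (sndᶠ (varᶠ 0F))
    (oracleᶠ 0F (pairᶠ (fstᶠ (fstᶠ (varᶠ 0F))) (litᶠ 0)))) (`∀ done))

  twinsᶠ : Functional 2 n → Functional 2 n
  twinsᶠ n = pairᶠ (pairᶠ n (litᶠ 0)) (pairᶠ n (litᶠ 1))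

  bound : Strategy 2 (`∀ ∷ `∀∞ ∷ []) 0
  bound = `∀ (`∀∞ (litᶠ 2 +ᶠ sndᶠ (fstᶠ (oracleᶠ 0F (pairᶠ (twinsᶠ (varᶠ 0F)) (litᶠ 0))))) done)

  unboundedTwins : Strategy 2 (`∃ ∷ `∀ ∷ `∃ ∷ []) 0
  unboundedTwins = `∃ (twinsᶠ block) (`∀ (`∃
    (pairᶠ block (oracleᶠ 0F (sucᶠ (pairᶠ (litᶠ 2 +ᶠ sndᶠ (fstᶠ (varᶠ 0F))) (litᶠ 0))))) done))
    where
    block : ∀ {l} → Functional 2 l
    block = oracleᶠ 0F (litᶠ 0)

  enumeration : Strategy 2 (`∃ ∷ `∃∞ ∷ []) 0
  enumeration = `∃ block (`∃∞
    (sndᶠ (oracleᶠ 0F (sucᶠ (pairᶠ (call₂ (shiftᶠ twinsMeetJoinᶠ) block (varᶠ 0F)) (litᶠ 0))))) done)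
    where
    block : ∀ {l} → Functional 2 l
    block = fstᶠ (fstᶠ (oracleᶠ 0F (litᶠ 0)))

theorem3p10 : Dicomplete (`∀ ∷ `∀∞ ∷ []) Lattice
theorem3p10 = 0 , 1 , eventuallyZero , eventuallyZero-strictlyDicomplete ,
  Lattice≤eventuallyZero , eventuallyZero≤Lattice
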